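{- Let $\mathscr{A}\subseteq\mathbb{N}$ be an OR$_+$ sequence with $\{0,1\}\subseteq\mathscr{A}$. Suppose that for some integer $h\geq 1$ there are a function $\mathfrak{S}_{\mathscr{A},h}:\mathbb{N}\to[0,+\infty)$ satisfying $$r_{\mathscr{A},h}(n)=\mathfrak{S}_{\mathscr{A},h}(n)J_{\mathscr{A},h}(n)+E(n),\qquad E(n)=o(r_{\mathscr{A},h}(n)),$$ and a real $\varepsilon>0$ such that $$\frac1x\sum_{n\leq x}\mathfrak{S}_{\mathscr{A},h}(n)^{1+\varepsilon}=O(1).$$ Then $\mathscr{A}$ is a stable additive basis.
   Context: $\mathbb{N}$ includes $0$. A sequence $\mathscr{A}=\{a_0<a_1<\cdots\}$ is an infinite subset of $\mathbb{N}$, with counting function $A(x)=|\mathscr{A}\cap[0,x]|$. $\mathscr{A}$ is an OR$_+$ sequence if both $A(2x)=O(A(x))$ and $a_{2n}=O(a_n)$. $r_{\mathscr{A},h}(n)$ is the number of ordered $h$-tuples in $\mathscr{A}^h$ with sum $n$. Define $$J_{\mathscr{A},h}(n)=\int_{\mathbb{R}/\mathbb{Z}}\Big(\sum_{k\leq n}\frac{A(k)}{k+1}e^{2\pi i k\alpha}\Big)^h e^{ -2\pi i n\alpha}\,d\alpha=\sum_{\substack{k_1+\cdots+k_h=n\\ k_1,\dots,k_h\geq 0}}\frac{A(k_1)}{k_1+1}\cdots\frac{A(k_h)}{k_h+1}.$$ The condition $E(n)=o(r_{\mathscr{A},h}(n))$ implies $\mathfrak{S}_{\mathscr{A},h}(n)\sim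 r_{\mathscr{A},h}(n)/J_{\mathscr{A},h}(n)$ as $n\to+\infty$ through $h\mathscr{A}=\{k_1+\cdots+k_h:k_i\in\mathscr{A}\}$. A sequence $\mathscr{A}$ is an additive basis if $g\mathscr{A}=\mathbb{N}$ for some integer $g\geq 2$. It is a stable (additive) basis if it is an additive basis and every subsequence $\mathscr{B}\subseteq\mathscr{A}$ with $\{0,1\}\subseteq\mathscr{B}$ and $B(x)=\Theta(A(x))$ is also an additive basis. -}

module Defs where

open import Algebra.Bundles using (CommutativeMonoid)
open import Data.Integer.Base using (+_)
open import Data.List.Base using (List; []; _∷_; map; concatMap; filter; foldr; length; upTo)
open import Data.Nat.Base as ℕ using (ℕ; zero; suc; _∸_)
import Data.Nat.Properties as ℕₚ
open import Data.Product.Base using (Σ-syntax; ∃-syntax; _×_; _,_)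
open import Data.Rational.Base as ℚ using (ℚ; 0ℚ; 1ℚ; ½; 1/_)
import Data.Rational.Properties as ℚₚ
open import Data.Sum.Base using (inj₁; inj₂)
open import Data.Vec.Base as Vec using (Vec; []; _∷_)
open import Data.Vec.Relation.Unary.All as All using (All)
open import Relation.Binary.PropositionalEquality using (_≡_; refl; sym; cong; cong₂; subst; module ≡-Reasoning)
open import Relation.Nullary.Decidable using (Dec; map′)

open import Algebra.Properties.AbelianGroup ℚₚ.+-0-abelianGroup using (//-rightDividesˡ; //-rightDividesʳ; ⁻¹-anti-homo‿-)
open import Algebra.Properties.CommutativeSemigroup (CommutativeMonoid.commutativeSemigroup ℚₚ.+-0-commutativeMonoid) using (interchange)
open import Algebra.Properties.Ring ℚₚ.+-*-ring using (x[y-z]≈xy-xz)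

private
  halves : ∀ p → ½ ℚ.* p ℚ.+ ½ ℚ.* p ≡ p
  halves p = begin
    ½ ℚ.* p ℚ.+ ½ ℚ.* p   ≡⟨ ℚₚ.*-distribʳ-+ p ½ ½ ⟨
    (½ ℚ.+ ½) ℚ.* p       ≡⟨⟩
    1ℚ ℚ.* p              ≡⟨ ℚₚ.*-identityˡ p ⟩
    p                     ∎
    where open ≡-Reasoning

  +-telescope : ∀ a b c d →
    (a ℚ.+ b) ℚ.- (c ℚ.+ d) ≡ (a ℚ.- c) ℚ.+ (b ℚ.- d)
  +-telescope a b c d = begin
    (a ℚ.+ b) ℚ.- (c ℚ.+ d)              ≡⟨ cong ((a ℚ.+ b) ℚ.+_) (ℚₚ.neg-distrib-+ c d) ⟩
    (a ℚ.+ b) ℚ.+ (ℚ.- c ℚ.+ ℚ.- d)      ≡⟨ interchange a b (ℚ.- c) (ℚ.- d) ⟩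
    (a ℚ.- c) ℚ.+ (b ℚ.- d)              ∎
    where open ≡-Reasoning

  *-telescope : ∀ a b c d →
    a ℚ.* b ℚ.- c ℚ.* d ≡ a ℚ.* (b ℚ.- d) ℚ.+ d ℚ.* (a ℚ.- c)
  *-telescope a b c d = begin
    a ℚ.* b ℚ.- c ℚ.* d
      ≡⟨ cong (ℚ._- c ℚ.* d) (//-rightDividesˡ (a ℚ.* d) (a ℚ.* b)) ⟨
    (a ℚ.* b ℚ.- a ℚ.* d) ℚ.+ a ℚ.* d ℚ.- c ℚ.* d
      ≡⟨ ℚₚ.+-assoc (a ℚ.* b ℚ.- a ℚ.* d) (a ℚ.* d) (ℚ.- (c ℚ.* d)) ⟩
    (a ℚ.* b ℚ.- a ℚ.* d) ℚ.+ (a ℚ.* d ℚ.- c ℚ.* d)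
      ≡⟨ cong₂ (λ u v → (a ℚ.* b ℚ.- a ℚ.* d) ℚ.+ (u ℚ.- v)) (ℚₚ.*-comm a d) (ℚₚ.*-comm c d) ⟩
    (a ℚ.* b ℚ.- a ℚ.* d) ℚ.+ (d ℚ.* a ℚ.- d ℚ.* c)
      ≡⟨ cong₂ ℚ._+_ (x[y-z]≈xy-xz a b d) (x[y-z]≈xy-xz d a c) ⟨
    a ℚ.* (b ℚ.- d) ℚ.+ d ℚ.* (a ℚ.- c)
      ∎
    where open ≡-Reasoning

  half-pos : ∀ {p} → 0ℚ ℚ.< p → 0ℚ ℚ.< ½ ℚ.* p
  half-pos {p} 0<p = ℚₚ.positive⁻¹ (½ ℚ.* p) {{ℚₚ.pos*pos⇒pos ½ p {{ℚ.positive 0<p}}}}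

  ∣p∣≤ : ∀ {p q} → p ℚ.≤ q → ℚ.- p ℚ.≤ q → ℚ.∣ p ∣ ℚ.≤ q
  ∣p∣≤ {p} {q} p≤q -p≤q with ℚₚ.∣p∣≡p∨∣p∣≡-p p
  ... | inj₁ eq = subst (ℚ._≤ q) (sym eq) p≤q
  ... | inj₂ eq = subst (ℚ._≤ q) (sym eq) -p≤q

  ∣p∣≤∣p-q∣+∣q∣ : ∀ p q → ℚ.∣ p ∣ ℚ.≤ ℚ.∣ p ℚ.- q ∣ ℚ.+ ℚ.∣ q ∣
  ∣p∣≤∣p-q∣+∣q∣ p q = begin
    ℚ.∣ p ∣                          ≡⟨ cong ℚ.∣_∣ (sym (//-rightDividesˡ q p)) ⟩
    ℚ.∣ (p ℚ.- q) ℚ.+ q ∣            ≤⟨ ℚₚ.∣p+q∣≤∣p∣+∣q∣ (p ℚ.- q) q ⟩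
    ℚ.∣ p ℚ.- q ∣ ℚ.+ ℚ.∣ q ∣        ∎
    where open ℚₚ.≤-Reasoning

  ∣p-q∣≡∣q-p∣ : ∀ p q → ℚ.∣ p ℚ.- q ∣ ≡ ℚ.∣ q ℚ.- p ∣
  ∣p-q∣≡∣q-p∣ p q = begin
    ℚ.∣ p ℚ.- q ∣           ≡⟨ ℚₚ.∣-p∣≡∣p∣ (p ℚ.- q) ⟨
    ℚ.∣ ℚ.- (p ℚ.- q) ∣     ≡⟨ cong ℚ.∣_∣ (⁻¹-anti-homo‿- p q) ⟩
    ℚ.∣ q ℚ.- p ∣           ∎
    where
    open ≡-Reasoning

  ∣p∣-∣q∣≤∣p-q∣ : ∀ p q → ℚ.∣ p ∣ ℚ.- ℚ.∣ q ∣ ℚ.≤ ℚ.∣ p ℚ.- q ∣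
  ∣p∣-∣q∣≤∣p-q∣ p q = begin
    ℚ.∣ p ∣ ℚ.- ℚ.∣ q ∣
      ≤⟨ ℚₚ.+-monoˡ-≤ (ℚ.- ℚ.∣ q ∣) (∣p∣≤∣p-q∣+∣q∣ p q) ⟩
    ℚ.∣ p ℚ.- q ∣ ℚ.+ ℚ.∣ q ∣ ℚ.- ℚ.∣ q ∣
      ≡⟨ //-rightDividesʳ ℚ.∣ q ∣ ℚ.∣ p ℚ.- q ∣ ⟩
    ℚ.∣ p ℚ.- q ∣
      ∎
    where open ℚₚ.≤-Reasoning

  ∣∣p∣-∣q∣∣≤∣p-q∣ : ∀ p q → ℚ.∣ ℚ.∣ p ∣ ℚ.- ℚ.∣ q ∣ ∣ ℚ.≤ ℚ.∣ p ℚ.- q ∣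
  ∣∣p∣-∣q∣∣≤∣p-q∣ p q = ∣p∣≤ (∣p∣-∣q∣≤∣p-q∣ p q) (begin
    ℚ.- (ℚ.∣ p ∣ ℚ.- ℚ.∣ q ∣)
      ≡⟨ ⁻¹-anti-homo‿- ℚ.∣ p ∣ ℚ.∣ q ∣ ⟩
    ℚ.∣ q ∣ ℚ.- ℚ.∣ p ∣
      ≤⟨ ∣p∣-∣q∣≤∣p-q∣ q p ⟩
    ℚ.∣ q ℚ.- p ∣
      ≡⟨ ∣p-q∣≡∣q-p∣ q p ⟩
    ℚ.∣ p ℚ.- q ∣
      ∎)
    where open ℚₚ.≤-Reasoning

-- A real number is a Cauchy sequence of rationals; equality of reals is _≃_.

IsCauchy : (ℕ → ℚ) → Set
IsCauchy x = ∀ (δ : ℚ) → 0ℚ ℚ.< δ →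
  ∃[ N ] (∀ m n → N ℕ.≤ m → N ℕ.≤ n → ℚ.∣ x m ℚ.- x n ∣ ℚ.≤ δ)

record ℝ : Set where
  constructor mkℝ
  field
    approx   : ℕ → ℚ
    isCauchy : IsCauchy approx

open ℝ public

infix 4 _≤_ _<_ _≃_

_≤_ : ℝ → ℝ → Set
x ≤ y = ∀ (δ : ℚ) → 0ℚ ℚ.< δ →
  ∃[ N ] (∀ n → N ℕ.≤ n → approx x n ℚ.≤ approx y n ℚ.+ δ)

_<_ : ℝ → ℝ → Set
x < y = ∃[ δ ] (0ℚ ℚ.< δ ×
  ∃[ N ] (∀ n → N ℕ.≤ n → approx x n ℚ.+ δ ℚ.≤ approx y n))

_≃_ : ℝ → ℝ → Set
x ≃ y = x ≤ y × y ≤ x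

fromℚ : ℚ → ℝ
fromℚ p = mkℝ (λ _ → p) λ δ 0<δ → 0 , λ _ _ _ _ →
  ℚₚ.≤-trans (ℚₚ.≤-reflexive (cong ℚ.∣_∣ (ℚₚ.+-inverseʳ p))) (ℚₚ.<⇒≤ 0<δ)

fromℕ : ℕ → ℝ
fromℕ n = fromℚ (+ n ℚ./ 1)

0ℝ 1ℝ : ℝ
0ℝ = fromℚ 0ℚ
1ℝ = fromℚ 1ℚ

private
  Cauchy-+ : ∀ x y → IsCauchy x → IsCauchy y → IsCauchy (λ n → x n ℚ.+ y n)
  Cauchy-+ x y cx cy δ 0<δ
    with cx (½ ℚ.* δ) (half-pos 0<δ) | cy (½ ℚ.* δ) (half-pos 0<δ)
  ... | M , hx | N , hy = M ℕ.⊔ N , λ m n m≥ n≥ → begin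
    ℚ.∣ (x m ℚ.+ y m) ℚ.- (x n ℚ.+ y n) ∣
      ≡⟨ cong ℚ.∣_∣ (+-telescope (x m) (y m) (x n) (y n)) ⟩
    ℚ.∣ (x m ℚ.- x n) ℚ.+ (y m ℚ.- y n) ∣
      ≤⟨ ℚₚ.∣p+q∣≤∣p∣+∣q∣ (x m ℚ.- x n) (y m ℚ.- y n) ⟩
    ℚ.∣ x m ℚ.- x n ∣ ℚ.+ ℚ.∣ y m ℚ.- y n ∣
      ≤⟨ ℚₚ.+-mono-≤
           (hx m n (ℕₚ.m⊔n≤o⇒m≤o M N m≥) (ℕₚ.m⊔n≤o⇒m≤o M N n≥))
           (hy m n (ℕₚ.m⊔n≤o⇒n≤o M N m≥) (ℕₚ.m⊔n≤o⇒n≤o M N n≥)) ⟩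
    ½ ℚ.* δ ℚ.+ ½ ℚ.* δ
      ≡⟨ halves δ ⟩
    δ ∎
    where open ℚₚ.≤-Reasoning

  Cauchy-∣∣ : ∀ x → IsCauchy x → IsCauchy (λ n → ℚ.∣ x n ∣)
  Cauchy-∣∣ x cx δ 0<δ with cx δ 0<δ
  ... | N , hx = N , λ m n m≥ n≥ →
    ℚₚ.≤-trans (∣∣p∣-∣q∣∣≤∣p-q∣ (x m) (x n)) (hx m n m≥ n≥)

  eventually-bounded : ∀ x → IsCauchy x →
    ∃[ N ] ∃[ K ] (0ℚ ℚ.≤ K × (∀ n → N ℕ.≤ n → ℚ.∣ x n ∣ ℚ.≤ K))
  eventually-bounded x cx with cx 1ℚ (ℚₚ.positive⁻¹ 1ℚ)
  ... | N , hx = N , 1ℚ ℚ.+ ℚ.∣ x N ∣ ,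
    ℚₚ.+-mono-≤ (ℚₚ.nonNegative⁻¹ 1ℚ) (ℚₚ.0≤∣p∣ (x N)) , λ n n≥ →
    ℚₚ.≤-trans (∣p∣≤∣p-q∣+∣q∣ (x n) (x N))
      (ℚₚ.+-monoˡ-≤ ℚ.∣ x N ∣ (hx n N n≥ ℕₚ.≤-refl))

  Cauchy-* : ∀ x y → IsCauchy x → IsCauchy y → IsCauchy (λ n → x n ℚ.* y n)
  Cauchy-* x y cx cy δ 0<δ with eventually-bounded x cx | eventually-bounded y cy
  ... | M , K , 0≤K , bx | N , L , 0≤L , by = go
    where
    open ℚₚ.≤-Reasoning
    T : ℚ
    T = 1ℚ ℚ.+ (K ℚ.+ L)
    instance
      T-pos : ℚ.Positive T
      T-pos = ℚₚ.pos+nonNeg⇒pos 1ℚ (K ℚ.+ L)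
        {{ℚ.nonNegative (ℚₚ.+-mono-≤ 0≤K 0≤L)}}
      T≢0 : ℚ.NonZero T
      T≢0 = ℚₚ.pos⇒nonZero T
    η : ℚ
    η = 1/ T ℚ.* δ
    instance
      η-pos : ℚ.Positive η
      η-pos = ℚₚ.pos*pos⇒pos (1/ T) {{ℚₚ.1/pos⇒pos T}} δ {{ℚ.positive 0<δ}}
    η≥0 : ℚ.NonNegative η
    η≥0 = ℚₚ.pos⇒nonNeg η
    mul-≤ : ∀ {p q B} → 0ℚ ℚ.≤ B → ℚ.∣ p ∣ ℚ.≤ B → ℚ.∣ q ∣ ℚ.≤ η → ℚ.∣ p ℚ.* q ∣ ℚ.≤ B ℚ.* η
    mul-≤ {p} {q} {B} 0≤B p≤ q≤ = begin
      ℚ.∣ p ℚ.* q ∣            ≡⟨ ℚₚ.∣p*q∣≡∣p∣*∣q∣ p q ⟩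
      ℚ.∣ p ∣ ℚ.* ℚ.∣ q ∣      ≤⟨ ℚₚ.*-monoʳ-≤-nonNeg ℚ.∣ q ∣ {{ℚ.nonNegative (ℚₚ.0≤∣p∣ q)}} p≤ ⟩
      B ℚ.* ℚ.∣ q ∣            ≤⟨ ℚₚ.*-monoˡ-≤-nonNeg B {{ℚ.nonNegative 0≤B}} q≤ ⟩
      B ℚ.* η                  ∎
    total : K ℚ.* η ℚ.+ L ℚ.* η ℚ.≤ δ
    total = begin
      K ℚ.* η ℚ.+ L ℚ.* η
        ≡⟨ ℚₚ.*-distribʳ-+ η K L ⟨
      (K ℚ.+ L) ℚ.* η
        ≡⟨ ℚₚ.+-identityˡ ((K ℚ.+ L) ℚ.* η) ⟨
      0ℚ ℚ.+ (K ℚ.+ L) ℚ.* η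
        ≤⟨ ℚₚ.+-monoˡ-≤ ((K ℚ.+ L) ℚ.* η) (ℚₚ.nonNegative⁻¹ η {{η≥0}}) ⟩
      η ℚ.+ (K ℚ.+ L) ℚ.* η
        ≡⟨ cong (ℚ._+ (K ℚ.+ L) ℚ.* η) (ℚₚ.*-identityˡ η) ⟨
      1ℚ ℚ.* η ℚ.+ (K ℚ.+ L) ℚ.* η
        ≡⟨ ℚₚ.*-distribʳ-+ η 1ℚ (K ℚ.+ L) ⟨
      T ℚ.* (1/ T ℚ.* δ)
        ≡⟨ ℚₚ.*-assoc T (1/ T) δ ⟨
      (T ℚ.* 1/ T) ℚ.* δ
        ≡⟨ cong (ℚ._* δ) (ℚₚ.*-inverseʳ T) ⟩
      1ℚ ℚ.* δ
        ≡⟨ ℚₚ.*-identityˡ δ ⟩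
      δ ∎
    go : ∃[ P ] (∀ m n → P ℕ.≤ m → P ℕ.≤ n → ℚ.∣ x m ℚ.* y m ℚ.- x n ℚ.* y n ∣ ℚ.≤ δ)
    go with cx η (ℚₚ.positive⁻¹ η) | cy η (ℚₚ.positive⁻¹ η)
    ... | M′ , hx | N′ , hy = (M ℕ.⊔ N) ℕ.⊔ (M′ ℕ.⊔ N′) , λ m n m≥ n≥ → begin
      ℚ.∣ x m ℚ.* y m ℚ.- x n ℚ.* y n ∣
        ≡⟨ cong ℚ.∣_∣ (*-telescope (x m) (y m) (x n) (y n)) ⟩
      ℚ.∣ x m ℚ.* (y m ℚ.- y n) ℚ.+ y n ℚ.* (x m ℚ.- x n) ∣
        ≤⟨ ℚₚ.∣p+q∣≤∣p∣+∣q∣ (x m ℚ.* (y m ℚ.- y n)) (y n ℚ.* (x m ℚ.- x n)) ⟩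
      ℚ.∣ x m ℚ.* (y m ℚ.- y n) ∣ ℚ.+ ℚ.∣ y n ℚ.* (x m ℚ.- x n) ∣
        ≤⟨ ℚₚ.+-mono-≤
             (mul-≤ {x m} {y m ℚ.- y n} 0≤K (bx m (ℕₚ.m⊔n≤o⇒m≤o M N (l m≥)))
               (hy m n (ℕₚ.m⊔n≤o⇒n≤o M′ N′ (r m≥)) (ℕₚ.m⊔n≤o⇒n≤o M′ N′ (r n≥))))
             (mul-≤ {y n} {x m ℚ.- x n} 0≤L (by n (ℕₚ.m⊔n≤o⇒n≤o M N (l n≥)))
               (hx m n (ℕₚ.m⊔n≤o⇒m≤o M′ N′ (r m≥)) (ℕₚ.m⊔n≤o⇒m≤o M′ N′ (r n≥)))) ⟩
      K ℚ.* η ℚ.+ L ℚ.* η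
        ≤⟨ total ⟩
      δ ∎
      where
      l : ∀ {k} → (M ℕ.⊔ N) ℕ.⊔ (M′ ℕ.⊔ N′) ℕ.≤ k → M ℕ.⊔ N ℕ.≤ k
      l = ℕₚ.m⊔n≤o⇒m≤o (M ℕ.⊔ N) (M′ ℕ.⊔ N′)
      r : ∀ {k} → (M ℕ.⊔ N) ℕ.⊔ (M′ ℕ.⊔ N′) ℕ.≤ k → M′ ℕ.⊔ N′ ℕ.≤ k
      r = ℕₚ.m⊔n≤o⇒n≤o (M ℕ.⊔ N) (M′ ℕ.⊔ N′)

infixl 6 _+_
infixl 7 _*_
infixr 8 _^_

_+_ : ℝ → ℝ → ℝ
x + y = mkℝ (λ n → approx x n ℚ.+ approx y n) (Cauchy-+ (approx x) (approx y) (isCauchy x) (isCauchy y))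

_*_ : ℝ → ℝ → ℝ
x * y = mkℝ (λ n → approx x n ℚ.* approx y n) (Cauchy-* (approx x) (approx y) (isCauchy x) (isCauchy y))

∣_∣ : ℝ → ℝ
∣ x ∣ = mkℝ (λ n → ℚ.∣ approx x n ∣) (Cauchy-∣∣ (approx x) (isCauchy x))

_^_ : ℝ → ℕ → ℝ
x ^ zero  = 1ℝ
x ^ suc n = x * x ^ n

∑≤ : ℕ → (ℕ → ℝ) → ℝ
∑≤ zero    f = f 0
∑≤ (suc n) f = ∑≤ n f + f (suc n)

-- IsPower x s y says that y = xˢ, for real x ≥ 0 and s > 0.  For x ≥ 1 (resp.
-- x ≤ 1), xˢ is the real number lying above (resp. below) every xᵗ with t ≤ s
-- rational, and on the other side of every xᵗ with t ≥ s; for t = a/b, xᵗ is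
-- the b-th root of xᵃ, so that xᵗ ≤ y iff xᵃ ≤ yᵇ.

record IsPower (x s y : ℝ) : Set where
  field
    nonNegative : 0ℝ ≤ y
    x≥1-lower : ∀ a b .{{_ : ℕ.NonZero b}} → 1ℝ ≤ x → fromℚ (+ a ℚ./ b) ≤ s → x ^ a ≤ y ^ b
    x≥1-upper : ∀ a b .{{_ : ℕ.NonZero b}} → 1ℝ ≤ x → s ≤ fromℚ (+ a ℚ./ b) → y ^ b ≤ x ^ a
    x≤1-upper : ∀ a b .{{_ : ℕ.NonZero b}} → x ≤ 1ℝ → fromℚ (+ a ℚ./ b) ≤ s → y ^ b ≤ x ^ a
    x≤1-lower : ∀ a b .{{_ : ℕ.NonZero b}} → x ≤ 1ℝ → s ≤ fromℚ (+ a ℚ./ b) → x ^ a ≤ y ^ b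

infix 4 _=O_ _=o_ _=Θ_

_=O_ : (f g : ℕ → ℝ) → Set
f =O g = ∃[ C ] ∃[ N ] (∀ n → N ℕ.≤ n → ∣ f n ∣ ≤ C * ∣ g n ∣)

_=o_ : (f g : ℕ → ℝ) → Set
f =o g = ∀ δ → 0ℝ < δ → ∃[ N ] (∀ n → N ℕ.≤ n → ∣ f n ∣ ≤ δ * ∣ g n ∣)

_=Θ_ : (f g : ℕ → ℝ) → Set
f =Θ g = f =O g × g =O f

-- mean f m is (1/x) ∑_{n ≤ x} f(n) at x = m + 1, which avoids x = 0.

mean : (ℕ → ℝ) → (ℕ → ℝ)
mean f m = fromℚ (+ 1 ℚ./ suc m) * ∑≤ (suc m) f

BoundedMoment : (ℕ → ℝ) → ℝ → Set
BoundedMoment f s = Σ[ fˢ ∈ (ℕ → ℝ) ]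
  (∀ n → IsPower (f n) s (fˢ n)) × mean fˢ =O (λ _ → 1ℝ)

record Sequence : Set where
  field
    term       : ℕ → ℕ
    increasing : ∀ n → term n ℕ.< term (suc n)

open Sequence public

infix 4 _∈_ _⊆_ _∈?_

_∈_ : ℕ → Sequence → Set
n ∈ 𝒜 = ∃[ k ] (term 𝒜 k ≡ n)

_⊆_ : Sequence → Sequence → Set
ℬ ⊆ 𝒜 = ∀ n → n ∈ ℬ → n ∈ 𝒜

k≤term : ∀ 𝒜 k → k ℕ.≤ term 𝒜 k
k≤term 𝒜 zero    = ℕ.z≤n
k≤term 𝒜 (suc k) = ℕₚ.≤-<-trans (k≤term 𝒜 k) (increasing 𝒜 k)

_∈?_ : ∀ n 𝒜 → Dec (n ∈ 𝒜)
n ∈? 𝒜 = map′ (λ (k , _ , eq) → k , eq) bound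
              (ℕₚ.anyUpTo? (λ k → term 𝒜 k ℕₚ.≟ n) (suc n))
  where
  bound : n ∈ 𝒜 → ∃[ k ] (k ℕ.< suc n × term 𝒜 k ≡ n)
  bound (k , refl) = k , ℕ.s≤s (k≤term 𝒜 k) , refl

count : Sequence → ℕ → ℕ
count 𝒜 x = length (filter (_∈? 𝒜) (upTo (suc x)))

-- Counting functions are step functions, so asymptotic conditions on them are
-- imposed at natural numbers x only.

OR₊ : Sequence → Set
OR₊ 𝒜 = (λ x → fromℕ (count 𝒜 (2 ℕ.* x))) =O (λ x → fromℕ (count 𝒜 x))
      × (λ n → fromℕ (term 𝒜 (2 ℕ.* n)))  =O (λ n → fromℕ (term 𝒜 n))

-- All (k₁ , … , kₕ) ∈ ℕʰ with k₁ + ⋯ + kₕ = n, each listed once.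

tuples : ∀ h → ℕ → List (Vec ℕ h)
tuples zero    zero    = [] ∷ []
tuples zero    (suc n) = []
tuples (suc h) n       = concatMap (λ k → map (k ∷_) (tuples h (n ∸ k))) (upTo (suc n))

rep : Sequence → ℕ → ℕ → ℕ
rep 𝒜 h n = length (filter (All.all? (_∈? 𝒜)) (tuples h n))

weight : Sequence → ∀ {h} → Vec ℕ h → ℚ
weight 𝒜 v = Vec.foldr′ ℚ._*_ 1ℚ (Vec.map (λ k → + count 𝒜 k ℚ./ suc k) v)

J : Sequence → ℕ → ℕ → ℚ
J 𝒜 h n = foldr ℚ._+_ 0ℚ (map (weight 𝒜) (tuples h n))

IsAdditiveBasis : Sequence → Set
IsAdditiveBasis 𝒜 = ∃[ g ] (2 ℕ.≤ g ×
  (∀ n → Σ[ v ∈ Vec ℕ g ] (All (_∈ 𝒜) v × Vec.sum v ≡ n)))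

IsStableBasis : Sequence → Set
IsStableBasis 𝒜 = IsAdditiveBasis 𝒜 ×
  (∀ ℬ → ℬ ⊆ 𝒜 → 0 ∈ ℬ → 1 ∈ ℬ →
   (λ x → fromℕ (count ℬ x)) =Θ (λ x → fromℕ (count 𝒜 x)) →
   IsAdditiveBasis ℬ)

{-# OPTIONS --safe #-}

-- Let r(n) be the number of representations of n as a sum of h elements of ℬ ⊆ 𝒜.
-- The regularity of 𝒜 gives J(n) ≪ A(n)ʰ / n, and a positive proportion of the
-- ≍ A(x)ʰ representations of the integers up to x are representations of
-- integers n ∈ (δx, x]; for these r(n) ≪ 𝔖(n) A(x)ʰ / x, so that the sum of 𝔖
-- over hℬ ∩ [0, x] is ≫ x.  The truncation 𝔖 ≤ M + 𝔖^(1+ε) / M^ε with a large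
-- constant M turns this into |hℬ ∩ [0, x]| ≫ x, and by Schnirelmann's theorem
-- hℬ, hence ℬ, is an additive basis.
--
-- Real numbers are needed only for the truncation: 𝔖(n)^(1+ε) is replaced by a
-- natural majorant with bounded mean, and each n is treated at one sufficiently
-- late index of the approximating sequences.

module Submission where

open import Algebra.Structures using (IsCommutativeSemiring)
open import Data.Nat.Base as ℕ using (ℕ; zero; suc)
import Data.Nat.Properties as ℕₚ
open import Relation.Binary.PropositionalEquality using (_≡_; refl; sym; trans; cong; cong₂; module ≡-Reasoning)
import Defs

-- The bound `a_{2n} = O(a_n)` enters as A(Qx) ≥ 2A(x) for a fixed Q. This makes the sum of
-- A(k)/(k+1) over k ≤ n at most a constant times A(n), whence the bound for J. Iterated, it also
-- outgrows the constant lost in passing from 𝒜 to ℬ, so that small integers cannot absorb most of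
-- the representations. The bound A(2x) = O(A(x)) works in the opposite direction and keeps A at the
-- top of the range comparable with B further down. The asymptotic formula concerns 𝒜 only, and what
-- passes to ℬ is r_ℬ ≤ r_𝒜. So only an upper bound for r_𝒜 is extracted, from |E| ≤ r/2 for large
-- n. The order of the constants matters: the dilation factors depend on 𝒜, ℬ and h, the truncation
-- gain L is chosen after them so as to beat the moment bound, and the cost M of the truncation
-- comes last and only affects the final density. Both r and J are h-fold convolution powers, of the
-- indicator of 𝒜 over ℕ and of A(k)/(k+1) over ℚ. This is the reason for an abstract semiring,
-- whose multiplication is monotone only under a sign condition, for the sake of ℚ.

record OrderedSemiring : Set₁ where
  infix  4 _≤_
  infixl 6 _+_
  infixl 7 _*_
  infixr 8 _^_
  field
    Carrier : Set
    _+_ _*_ : Carrier → Carrier → Carrier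
    0# 1#   : Carrier
    _≤_     : Carrier → Carrier → Set
    isCommutativeSemiring : IsCommutativeSemiring _≡_ _+_ _*_ 0# 1#
    ≤-refl    : ∀ {x} → x ≤ x
    ≤-trans   : ∀ {x y z} → x ≤ y → y ≤ z → x ≤ z
    +-mono-≤  : ∀ {x y u v} → x ≤ y → u ≤ v → x + u ≤ y + v
    *-monoˡ-≤ : ∀ {x y z} → 0# ≤ z → x ≤ y → z * x ≤ z * y
    0≤1       : 0# ≤ 1#

  _^_ : Carrier → ℕ → Carrier
  x ^ zero  = 1#
  x ^ suc n = x * x ^ n

-- Finite sums and additive convolution over an ordered semiring.

module Sums (R : OrderedSemiring) where
  open OrderedSemiring R
  open IsCommutativeSemiring isCommutativeSemiring
    using (+-assoc; +-comm; +-identityˡ; +-identityʳ; *-assoc; *-comm; *-identityˡ; *-identityʳ;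
           distribˡ; distribʳ; zeroˡ; zeroʳ)
  open import Data.List.Base as List using (List; []; _∷_; applyUpTo)
  import Data.List.Properties as Listₚ
  open import Data.Vec.Base as Vec using (Vec; []; _∷_)

  private variable
    f g : ℕ → Carrier
    x y u v : Carrier

  private
    ≤-reflexive : x ≡ y → x ≤ y
    ≤-reflexive refl = ≤-refl

    +-nonneg : 0# ≤ x → 0# ≤ y → 0# ≤ x + y
    +-nonneg {x} {y} 0≤x 0≤y = ≤-trans (≤-reflexive (sym (+-identityˡ 0#))) (+-mono-≤ 0≤x 0≤y)

    *-nonneg : 0# ≤ x → 0# ≤ y → 0# ≤ x * y
    *-nonneg {x} {y} 0≤x 0≤y = ≤-trans (≤-reflexive (sym (zeroʳ x))) (*-monoˡ-≤ 0≤x 0≤y)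

    *-mono-≤ : 0# ≤ x → 0# ≤ v → x ≤ y → u ≤ v → x * u ≤ y * v
    *-mono-≤ {x} {v} {y} {u} 0≤x 0≤v x≤y u≤v = ≤-trans (*-monoˡ-≤ 0≤x u≤v)
      (≤-trans (≤-reflexive (*-comm x v)) (≤-trans (*-monoˡ-≤ 0≤v x≤y) (≤-reflexive (*-comm v y))))

    +-interchange : ∀ a b c d → (a + b) + (c + d) ≡ (a + c) + (b + d)
    +-interchange a b c d = begin
      (a + b) + (c + d)  ≡⟨ +-assoc a b (c + d) ⟩
      a + (b + (c + d))  ≡⟨ cong (a +_) (+-assoc b c d) ⟨
      a + (b + c + d)    ≡⟨ cong (λ z → a + (z + d)) (+-comm b c) ⟩
      a + (c + b + d)    ≡⟨ cong (a +_) (+-assoc c b d) ⟩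
      a + (c + (b + d))  ≡⟨ +-assoc a c (b + d) ⟨
      (a + c) + (b + d)  ∎
      where open ≡-Reasoning

  sum : (ℕ → Carrier) → ℕ → Carrier
  sum f zero    = 0#
  sum f (suc n) = f 0 + sum (λ k → f (suc k)) n

  sum-cong : (∀ k → f k ≡ g k) → ∀ n → sum f n ≡ sum g n
  sum-cong f≡g zero    = refl
  sum-cong f≡g (suc n) = cong₂ _+_ (f≡g 0) (sum-cong (λ k → f≡g (suc k)) n)

  sum-mono : ∀ n → (∀ k → k ℕ.< n → f k ≤ g k) → sum f n ≤ sum g n
  sum-mono zero    f≤g = ≤-refl
  sum-mono (suc n) f≤g =
    +-mono-≤ (f≤g 0 ℕ.z<s) (sum-mono n (λ k k<n → f≤g (suc k) (ℕ.s≤s k<n)))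

  sum-nonneg : (∀ k → 0# ≤ f k) → ∀ n → 0# ≤ sum f n
  sum-nonneg 0≤f zero    = ≤-refl
  sum-nonneg 0≤f (suc n) = +-nonneg (0≤f 0) (sum-nonneg (λ k → 0≤f (suc k)) n)

  sum-++ : ∀ f m n → sum f (m ℕ.+ n) ≡ sum f m + sum (λ k → f (m ℕ.+ k)) n
  sum-++ f zero    n = sym (+-identityˡ _)
  sum-++ f (suc m) n = trans (cong (f 0 +_) (sum-++ (λ k → f (suc k)) m n)) (sym (+-assoc _ _ _))

  sum-∷ʳ : ∀ f n → sum f (suc n) ≡ sum f n + f n
  sum-∷ʳ f zero    = +-comm (f 0) 0#
  sum-∷ʳ f (suc n) = trans (cong (f 0 +_) (sum-∷ʳ (λ k → f (suc k)) n)) (sym (+-assoc _ _ _))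

  sum-+ : ∀ f g n → sum (λ k → f k + g k) n ≡ sum f n + sum g n
  sum-+ f g zero    = sym (+-identityˡ 0#)
  sum-+ f g (suc n) = trans (cong (f 0 + g 0 +_) (sum-+ (λ k → f (suc k)) (λ k → g (suc k)) n))
    (+-interchange _ _ _ _)

  sum-*ˡ : ∀ c f n → sum (λ k → c * f k) n ≡ c * sum f n
  sum-*ˡ c f zero    = sym (zeroʳ c)
  sum-*ˡ c f (suc n) = trans (cong (c * f 0 +_) (sum-*ˡ c (λ k → f (suc k)) n)) (sym (distribˡ c _ _))

  sum-*ʳ : ∀ c f n → sum (λ k → f k * c) n ≡ sum f n * c
  sum-*ʳ c f n = trans (sum-cong (λ k → *-comm (f k) c) n) (trans (sum-*ˡ c f n) (*-comm c _))

  sum-reverse : ∀ f n → sum (λ k → f (n ℕ.∸ suc k)) n ≡ sum f n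
  sum-reverse f zero    = refl
  sum-reverse f (suc n) = begin
    f n + sum (λ k → f (n ℕ.∸ suc k)) n  ≡⟨ cong (f n +_) (sum-reverse f n) ⟩
    f n + sum f n                        ≡⟨ +-comm (f n) _ ⟩
    sum f n + f n                        ≡⟨ sum-∷ʳ f n ⟨
    sum f (suc n)                        ∎
    where open ≡-Reasoning

  sum-monoʳ : (∀ k → 0# ≤ f k) → ∀ {m n} → m ℕ.≤ n → sum f m ≤ sum f n
  sum-monoʳ 0≤f {n = n} ℕ.z≤n   = sum-nonneg 0≤f n
  sum-monoʳ 0≤f (ℕ.s≤s m≤n) = +-mono-≤ ≤-refl (sum-monoʳ (λ k → 0≤f (suc k)) m≤n)

  conv : (ℕ → Carrier) → (ℕ → Carrier) → ℕ → Carrier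
  conv f g n = sum (λ k → f k * g (n ℕ.∸ k)) (suc n)

  -- Cuts the triangle k + l ≤ n along the column k = 0. What remains is a triangle of the same
  -- kind, one size smaller, for the shifted f; both inductions below run on this.
  sum-conv-suc : ∀ f g n → sum (conv f g) (suc n) ≡
    f 0 * sum g (suc n) + sum (conv (λ k → f (suc k)) g) n
  sum-conv-suc f g n = begin
    (f 0 * g 0 + 0#) + sum (λ j → f 0 * g (suc j) + conv f′ g j) n
      ≡⟨ cong₂ _+_ (+-identityʳ _) (sum-+ (λ j → f 0 * g (suc j)) (conv f′ g) n) ⟩
    f 0 * g 0 + (sum (λ j → f 0 * g (suc j)) n + sum (conv f′ g) n)
      ≡⟨ +-assoc _ _ _ ⟨
    f 0 * g 0 + sum (λ j → f 0 * g (suc j)) n + sum (conv f′ g) n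
      ≡⟨ cong (_+ sum (conv f′ g) n) (sum-*ˡ (f 0) g (suc n)) ⟩
    f 0 * sum g (suc n) + sum (conv f′ g) n
      ∎
    where
    open ≡-Reasoning
    f′ : ℕ → Carrier
    f′ k = f (suc k)

  -- The triangle k + l < n lies inside the square k, l < n.
  sum-conv-≤ : (∀ k → 0# ≤ f k) → (∀ k → 0# ≤ g k) →
    ∀ n → sum (conv f g) n ≤ sum f n * sum g n
  sum-conv-≤ 0≤f 0≤g zero = ≤-reflexive (sym (zeroˡ _))
  sum-conv-≤ {f} {g} 0≤f 0≤g (suc n) = ≤-trans (≤-reflexive (sum-conv-suc f g n))
    (≤-trans (+-mono-≤ ≤-refl (≤-trans (sum-conv-≤ (λ k → 0≤f (suc k)) 0≤g n)
      (*-monoˡ-≤ (sum-nonneg (λ k → 0≤f (suc k)) n) (sum-monoʳ 0≤g (ℕₚ.n≤1+n n)))))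
    (≤-reflexive (sym (distribʳ _ _ _))))

  -- The rectangle k ≤ m, l ≤ n lies inside the triangle k + l ≤ m + n.
  sum-conv-≥ : (∀ k → 0# ≤ f k) → (∀ k → 0# ≤ g k) →
    ∀ m n → sum f (suc m) * sum g (suc n) ≤ sum (conv f g) (suc (m ℕ.+ n))
  sum-conv-≥ {f} {g} 0≤f 0≤g zero n = ≤-trans (≤-reflexive (cong (_* sum g (suc n)) (+-identityʳ (f 0))))
    (≤-trans (≤-trans (≤-reflexive (sym (+-identityʳ _))) (+-mono-≤ ≤-refl (sum-nonneg 0≤conv n)))
    (≤-reflexive (sym (sum-conv-suc f g n))))
    where
    0≤conv : ∀ k → 0# ≤ conv (λ k → f (suc k)) g k
    0≤conv k = sum-nonneg (λ j → *-nonneg (0≤f (suc j)) (0≤g (k ℕ.∸ j))) (suc k)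
  sum-conv-≥ {f} {g} 0≤f 0≤g (suc m) n = ≤-trans (≤-reflexive (distribʳ _ _ _))
    (≤-trans (+-mono-≤ (*-monoˡ-≤ (0≤f 0) (sum-monoʳ 0≤g (ℕ.s≤s (ℕₚ.m≤n+m n (suc m)))))
                       (sum-conv-≥ (λ k → 0≤f (suc k)) 0≤g m n))
    (≤-reflexive (sym (sum-conv-suc f g (suc m ℕ.+ n)))))

  sumList : List Carrier → Carrier
  sumList = List.foldr _+_ 0#

  sumList-++ : ∀ xs ys → sumList (xs List.++ ys) ≡ sumList xs + sumList ys
  sumList-++ []       ys = sym (+-identityˡ _)
  sumList-++ (x ∷ xs) ys = trans (cong (x +_) (sumList-++ xs ys)) (sym (+-assoc _ _ _))

  sumList-*ˡ : ∀ c xs → sumList (List.map (c *_) xs) ≡ c * sumList xs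
  sumList-*ˡ c []       = sym (zeroʳ c)
  sumList-*ˡ c (x ∷ xs) = trans (cong (c * x +_) (sumList-*ˡ c xs)) (sym (distribˡ c _ _))

  sumList-applyUpTo : ∀ f n → sumList (applyUpTo f n) ≡ sum f n
  sumList-applyUpTo f zero    = refl
  sumList-applyUpTo f (suc n) = cong (f 0 +_) (sumList-applyUpTo (λ k → f (suc k)) n)

  prod : (ℕ → Carrier) → ∀ {h} → Vec ℕ h → Carrier
  prod f v = Vec.foldr′ _*_ 1# (Vec.map f v)

  -- The h-fold additive convolution power of f, in the shape of the definitions of rep and J.
  convPower : (ℕ → Carrier) → ℕ → ℕ → Carrier
  convPower f h n = sumList (List.map (prod f) (Defs.tuples h n))

  -- `tuples` is grouped by the first coordinate, and the block with first coordinate k contributes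
  -- f k times a lower convolution power at n - k. All later estimates use this recursion instead of
  -- the lists.
  convPower-suc : ∀ f h n → convPower f (suc h) n ≡ conv f (convPower f h) n
  convPower-suc f h n = begin
    sumList (List.map (prod f) (List.concatMap F (List.upTo (suc n))))
      ≡⟨ blocks (List.upTo (suc n)) ⟩
    sumList (List.map (λ k → f k * convPower f h (n ℕ.∸ k)) (List.upTo (suc n)))
      ≡⟨ cong sumList (Listₚ.map-upTo _ (suc n)) ⟩
    sumList (applyUpTo (λ k → f k * convPower f h (n ℕ.∸ k)) (suc n))
      ≡⟨ sumList-applyUpTo (λ k → f k * convPower f h (n ℕ.∸ k)) (suc n) ⟩
    conv f (convPower f h) n ∎
    where
    open ≡-Reasoning
    F : ℕ → List (Vec ℕ (suc h))
    F k = List.map (k ∷_) (Defs.tuples h (n ℕ.∸ k))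
    blocks : ∀ ks → sumList (List.map (prod f) (List.concatMap F ks)) ≡
                    sumList (List.map (λ k → f k * convPower f h (n ℕ.∸ k)) ks)
    blocks []       = refl
    blocks (k ∷ ks) = begin
      sumList (List.map (prod f) (F k List.++ List.concatMap F ks))
        ≡⟨ cong sumList (Listₚ.map-++ (prod f) (F k) _) ⟩
      sumList (List.map (prod f) (F k) List.++ List.map (prod f) (List.concatMap F ks))
        ≡⟨ sumList-++ (List.map (prod f) (F k)) _ ⟩
      sumList (List.map (prod f) (F k)) + sumList (List.map (prod f) (List.concatMap F ks))
        ≡⟨ cong₂ _+_ block (blocks ks) ⟩
      f k * convPower f h (n ℕ.∸ k) + sumList (List.map (λ k → f k * convPower f h (n ℕ.∸ k)) ks) ∎
      where
      ts : List (Vec ℕ h)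
      ts = Defs.tuples h (n ℕ.∸ k)
      block : sumList (List.map (prod f) (F k)) ≡ f k * convPower f h (n ℕ.∸ k)
      block = begin
        sumList (List.map (prod f) (List.map (k ∷_) ts))   ≡⟨ cong sumList (Listₚ.map-∘ ts) ⟨
        sumList (List.map (λ v → f k * prod f v) ts)       ≡⟨ cong sumList (Listₚ.map-∘ ts) ⟩
        sumList (List.map (f k *_) (List.map (prod f) ts)) ≡⟨ sumList-*ˡ (f k) (List.map (prod f) ts) ⟩
        f k * convPower f h (n ℕ.∸ k)                      ∎

  convPower-nonneg : (∀ k → 0# ≤ f k) → ∀ h n → 0# ≤ convPower f h n
  convPower-nonneg 0≤f zero zero    = +-nonneg 0≤1 ≤-refl
  convPower-nonneg 0≤f zero (suc n) = ≤-refl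
  convPower-nonneg {f} 0≤f (suc h) n = ≤-trans
    (sum-nonneg (λ k → *-nonneg (0≤f k) (convPower-nonneg 0≤f h (n ℕ.∸ k))) (suc n))
    (≤-reflexive (sym (convPower-suc f h n)))

  convPower-mono : (∀ k → 0# ≤ f k) → (∀ k → f k ≤ g k) →
    ∀ h n → convPower f h n ≤ convPower g h n
  convPower-mono 0≤f f≤g zero zero    = ≤-refl
  convPower-mono 0≤f f≤g zero (suc n) = ≤-refl
  convPower-mono {f} {g} 0≤f f≤g (suc h) n = ≤-trans (≤-reflexive (convPower-suc f h n)) (≤-trans
    (sum-mono (suc n) (λ k _ → *-mono-≤ (0≤f k)
      (convPower-nonneg (λ j → ≤-trans (0≤f j) (f≤g j)) h (n ℕ.∸ k))
      (f≤g k) (convPower-mono 0≤f f≤g h (n ℕ.∸ k))))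
    (≤-reflexive (sym (convPower-suc g h n))))

  sum-convPower-≤ : (∀ k → 0# ≤ f k) → ∀ h n → sum (convPower f h) n ≤ sum f n ^ h
  sum-convPower-≤ 0≤f zero zero    = 0≤1
  sum-convPower-≤ 0≤f zero (suc n) = ≤-reflexive (trans (cong₂ _+_ (+-identityʳ 1#) (zeros n)) (+-identityʳ 1#))
    where
    zeros : ∀ n → sum (λ _ → 0#) n ≡ 0#
    zeros zero    = refl
    zeros (suc n) = trans (+-identityˡ _) (zeros n)
  sum-convPower-≤ {f} 0≤f (suc h) n = ≤-trans (≤-reflexive (sum-cong (convPower-suc f h) n))
    (≤-trans (sum-conv-≤ 0≤f (convPower-nonneg 0≤f h) n)
             (*-monoˡ-≤ (sum-nonneg 0≤f n) (sum-convPower-≤ 0≤f h n)))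

  -- Coordinates at most m have sum at most h m: the cube lies in the simplex.
  sum-convPower-≥ : (∀ k → 0# ≤ f k) → ∀ h m → sum f (suc m) ^ h ≤ sum (convPower f h) (suc (h ℕ.* m))
  sum-convPower-≥ 0≤f zero    m = ≤-reflexive (sym (trans (+-identityʳ _) (+-identityʳ 1#)))
  sum-convPower-≥ {f} 0≤f (suc h) m =
    ≤-trans (*-monoˡ-≤ (sum-nonneg 0≤f (suc m)) (sum-convPower-≥ 0≤f h m))
    (≤-trans (sum-conv-≥ 0≤f (convPower-nonneg 0≤f h) m (h ℕ.* m))
    (≤-reflexive (sum-cong (λ n → sym (convPower-suc f h n)) (suc (m ℕ.+ h ℕ.* m)))))

ℕ-orderedSemiring : OrderedSemiring
ℕ-orderedSemiring = record
  { isCommutativeSemiring = ℕₚ.+-*-isCommutativeSemiring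
  ; _≤_       = ℕ._≤_
  ; ≤-refl    = ℕₚ.≤-refl
  ; ≤-trans   = ℕₚ.≤-trans
  ; +-mono-≤  = ℕₚ.+-mono-≤
  ; *-monoˡ-≤ = λ {_} {_} {z} _ → ℕₚ.*-monoʳ-≤ z
  ; 0≤1       = ℕ.z≤n
  }

-- Schnirelmann's theorem: a set containing 0 and of positive density is a basis.

module Schnirelmann where
  open import Data.Nat.Base
  open import Data.Nat.Properties
  open import Data.Nat.Solver using (module +-*-Solver)
  open import Data.Product.Base using (∃-syntax; _×_; _,_)
  open import Relation.Binary.PropositionalEquality
  open import Relation.Nullary
  open import Relation.Nullary.Decidable using (_×-dec_)
  open import Relation.Nullary.Negation using (contradiction)
  open import Relation.Unary using (Decidable)
  open Sums ℕ-orderedSemiring using (sum; sum-++; sum-∷ʳ; sum-+; sum-mono; sum-cong; sum-reverse)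

  𝟙 : {P : Set} → Dec P → ℕ
  𝟙 (yes _) = 1
  𝟙 (no _)  = 0

  𝟙ᶜ : {P : Set} → Dec P → ℕ
  𝟙ᶜ (yes _) = 0
  𝟙ᶜ (no _)  = 1

  𝟙+𝟙ᶜ : {P : Set} (d : Dec P) → 𝟙 d + 𝟙ᶜ d ≡ 1
  𝟙+𝟙ᶜ (yes _) = refl
  𝟙+𝟙ᶜ (no _)  = refl

  𝟙ᶜ-anti : {P Q : Set} → (P → Q) → (p : Dec P) (q : Dec Q) → 𝟙ᶜ q ≤ 𝟙ᶜ p
  𝟙ᶜ-anti P⇒Q p        (yes _) = z≤n
  𝟙ᶜ-anti P⇒Q (yes p) (no ¬q) = contradiction (P⇒Q p) ¬q
  𝟙ᶜ-anti P⇒Q (no _)  (no _)  = ≤-refl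

  sum-ones : ∀ n → sum (λ _ → 1) n ≡ n
  sum-ones zero    = refl
  sum-ones (suc n) = cong suc (sum-ones n)

  -- Both count in [1, n]; as in Schnirelmann's density, 0 is left out.
  members nonmembers : {S : ℕ → Set} → Decidable S → ℕ → ℕ
  members    S? n = sum (λ i → 𝟙 (S? (suc i))) n
  nonmembers S? n = sum (λ i → 𝟙ᶜ (S? (suc i))) n

  members+nonmembers : {S : ℕ → Set} (S? : Decidable S) → ∀ n → members S? n + nonmembers S? n ≡ n
  members+nonmembers S? n = trans (sym (sum-+ (λ i → 𝟙 (S? (suc i))) (λ i → 𝟙ᶜ (S? (suc i))) n))
    (trans (sum-cong (λ i → 𝟙+𝟙ᶜ (S? (suc i))) n) (sum-ones n))

  infixl 6 _⊕_ _⊕?_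

  _⊕_ : (S T : ℕ → Set) → ℕ → Set
  (S ⊕ T) n = ∃[ m ] (m < suc n × S m × T (n ∸ m))

  _⊕?_ : {S T : ℕ → Set} → Decidable S → Decidable T → Decidable (S ⊕ T)
  (S? ⊕? T?) n = anyUpTo? (λ m → S? m ×-dec T? (n ∸ m)) (suc n)

  +-∈-⊕ : (S T : ℕ → Set) → ∀ {m n} → S m → T n → (S ⊕ T) (m + n)
  +-∈-⊕ S T {m} {n} Sm Tn = m , s≤s (m≤m+n m n) , Sm , subst T (sym (m+n∸m≡n m n)) Tn

  -- Split [1, n] at the last element m of S: the translates m + t, t ∈ T, fill
  -- all but nonmembers T (n − m) of the gap (m, n].
  module _ {S T : ℕ → Set} (S? : Decidable S) (T? : Decidable T) (S0 : S 0) (T0 : T 0) (p : ℕ)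
           (T-dense : ∀ n → suc p * nonmembers T? n ≤ p * n) where
    private
      -- Here d is the length of the gap after m. The last component carries the desired inequality
      -- at m, to which `bound` adds the contribution of the gap; thus the inequality and the
      -- position of m are obtained in one induction.
      LastMember : ℕ → Set
      LastMember n = ∃[ m ] ∃[ d ] (m + d ≡ n × S m × nonmembers S? n ≡ nonmembers S? m + d ×
        suc p * nonmembers (S? ⊕? T?) m ≤ p * nonmembers S? m)

      bound : ∀ {n} → LastMember n → suc p * nonmembers (S? ⊕? T?) n ≤ p * nonmembers S? n
      bound (m , d , refl , Sm , eq , IH) = begin
        suc p * nonmembers (S? ⊕? T?) (m + d)
          ≡⟨ cong (suc p *_) (sum-++ (λ i → 𝟙ᶜ ((S? ⊕? T?) (suc i))) m d) ⟩
        suc p * (nonmembers (S? ⊕? T?) m + sum (λ i → 𝟙ᶜ ((S? ⊕? T?) (suc (m + i)))) d)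
          ≤⟨ *-monoʳ-≤ (suc p) (+-monoʳ-≤ (nonmembers (S? ⊕? T?) m) (sum-mono d λ i _ →
               𝟙ᶜ-anti (λ Ti → subst (S ⊕ T) (+-suc m i) (+-∈-⊕ S T Sm Ti)) (T? (suc i)) _)) ⟩
        suc p * (nonmembers (S? ⊕? T?) m + nonmembers T? d)
          ≡⟨ *-distribˡ-+ (suc p) (nonmembers (S? ⊕? T?) m) (nonmembers T? d) ⟩
        suc p * nonmembers (S? ⊕? T?) m + suc p * nonmembers T? d
          ≤⟨ +-mono-≤ IH (T-dense d) ⟩
        p * nonmembers S? m + p * d
          ≡⟨ *-distribˡ-+ p (nonmembers S? m) d ⟨
        p * (nonmembers S? m + d)
          ≡⟨ cong (p *_) eq ⟨
        p * nonmembers S? (m + d) ∎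
        where open ≤-Reasoning

      lastMember : ∀ n → LastMember n
      lastMember zero = 0 , 0 , refl , S0 , refl , ≤-reflexive (trans (*-zeroʳ (suc p)) (sym (*-zeroʳ p)))
      lastMember (suc n) with lastMember n | S? (suc n) in eqS
      -- The new integer n + 1 = (n + 1) + 0 lies in the sumset because 0 ∈ T, so it adds no
      -- nonmember, and the inequality at n, taken from the previous last member, carries over.
      ... | last | yes Sn = suc n , 0 , +-identityʳ (suc n) , Sn , sym (+-identityʳ _) , (begin
        suc p * nonmembers (S? ⊕? T?) (suc n)
          ≡⟨ cong (suc p *_) (sum-∷ʳ (λ i → 𝟙ᶜ ((S? ⊕? T?) (suc i))) n) ⟩
        suc p * (nonmembers (S? ⊕? T?) n + 𝟙ᶜ ((S? ⊕? T?) (suc n)))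
          ≤⟨ *-monoʳ-≤ (suc p) (+-monoʳ-≤ (nonmembers (S? ⊕? T?) n) (𝟙ᶜ-anti
               (λ _ → subst (S ⊕ T) (+-identityʳ (suc n)) (+-∈-⊕ S T Sn T0)) (yes Sn) _)) ⟩
        suc p * (nonmembers (S? ⊕? T?) n + 0)
          ≡⟨ cong (suc p *_) (+-identityʳ _) ⟩
        suc p * nonmembers (S? ⊕? T?) n
          ≤⟨ bound last ⟩
        p * nonmembers S? n
          ≤⟨ *-monoʳ-≤ p (m≤m+n _ (𝟙ᶜ (S? (suc n)))) ⟩
        p * (nonmembers S? n + 𝟙ᶜ (S? (suc n)))
          ≡⟨ cong (p *_) (sum-∷ʳ (λ i → 𝟙ᶜ (S? (suc i))) n) ⟨
        p * nonmembers S? (suc n) ∎)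
        where open ≤-Reasoning
      ... | m , d , eq , Sm , gap , IH | no ¬Sn =
        m , suc d , trans (+-suc m d) (cong suc eq) , Sm , (begin
        nonmembers S? (suc n)                   ≡⟨ sum-∷ʳ (λ i → 𝟙ᶜ (S? (suc i))) n ⟩
        nonmembers S? n + 𝟙ᶜ (S? (suc n))       ≡⟨ cong₂ (λ a b → a + 𝟙ᶜ b) gap eqS ⟩
        nonmembers S? m + d + 1                 ≡⟨ +-assoc (nonmembers S? m) d 1 ⟩
        nonmembers S? m + (d + 1)               ≡⟨ cong (nonmembers S? m +_) (+-comm d 1) ⟩
        nonmembers S? m + suc d                 ∎) , IH
        where open ≡-Reasoning

    -- Pointwise form, without division, of Schnirelmann's inequality 1 - σ(S + T) ≤ (1 - σ(S)) (1 -
    -- σ(T)), where 1 - σ(T) ≤ p / (p + 1).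
    nonmembers-⊕ : ∀ n → suc p * nonmembers (S? ⊕? T?) n ≤ p * nonmembers S? n
    nonmembers-⊕ n = bound (lastMember n)

  -- If at most half of [1, n] lies outside S, then a ↦ n − a cannot map S off itself.
  half-dense⇒⊕ : {S : ℕ → Set} (S? : Decidable S) → S 0 → ∀ n → 2 * nonmembers S? n ≤ n → (S ⊕ S) n
  half-dense⇒⊕ {S} S? S0 n few with (S? ⊕? S?) n
  ... | yes n∈ = n∈
  ... | no n∉ = contradiction (begin-strict
    n                          <⟨ n<1+n n ⟩
    suc n                      ≡⟨ sum-ones (suc n) ⟨
    sum (λ _ → 1) (suc n)      ≤⟨ sum-mono (suc n) one-misses ⟩
    sum (λ a → 𝟙ᶜ (S? a) + 𝟙ᶜ (S? (n ∸ a))) (suc n)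
                               ≡⟨ sum-+ (λ a → 𝟙ᶜ (S? a)) (λ a → 𝟙ᶜ (S? (n ∸ a))) (suc n) ⟩
    u + sum (λ a → 𝟙ᶜ (S? (n ∸ a))) (suc n)
                               ≡⟨ cong (u +_) (sum-reverse (λ a → 𝟙ᶜ (S? a)) (suc n)) ⟩
    u + u                      ≡⟨ cong (u +_) (+-identityʳ u) ⟨
    2 * u                      ≤⟨ *-monoʳ-≤ 2 (+-monoˡ-≤ (nonmembers S? n) (𝟙ᶜ-anti (λ _ → S0) (yes S0) (S? 0))) ⟩
    2 * nonmembers S? n        ≤⟨ few ⟩
    n                          ∎) (<-irrefl refl)
    where
    open ≤-Reasoning
    u : ℕ
    u = sum (λ a → 𝟙ᶜ (S? a)) (suc n)
    one-misses : ∀ a → a < suc n → 1 ≤ 𝟙ᶜ (S? a) + 𝟙ᶜ (S? (n ∸ a))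
    one-misses a a≤n with S? a | S? (n ∸ a)
    ... | yes Sa | yes Sb = contradiction (a , a≤n , Sa , Sb) n∉
    ... | yes _  | no _   = ≤-refl
    ... | no _   | _      = s≤s z≤n

  -- Bernoulli's inequality 1 + j/p ≤ (1 + 1/p)^j with the denominators cleared, which also admits p
  -- = 0.
  bernoulli : ∀ p j → p ^ j * (p + j) ≤ suc p ^ j * p
  bernoulli p zero    = ≤-reflexive (cong (1 *_) (+-identityʳ p))
  bernoulli p (suc j) = begin
    p * p ^ j * (p + suc j)        ≡⟨ solve 3 (λ p q j → p :* q :* (p :+ (con 1 :+ j)) := q :* (p :* p :+ p :* j :+ p)) refl p (p ^ j) j ⟩
    p ^ j * (p * p + p * j + p)    ≤⟨ *-monoʳ-≤ (p ^ j) (m≤m+n _ j) ⟩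
    p ^ j * (p * p + p * j + p + j) ≡⟨ solve 3 (λ p q j → q :* (p :* p :+ p :* j :+ p :+ j) := (con 1 :+ p) :* (q :* (p :+ j))) refl p (p ^ j) j ⟩
    suc p * (p ^ j * (p + j))      ≤⟨ *-monoʳ-≤ (suc p) (bernoulli p j) ⟩
    suc p * (suc p ^ j * p)        ≡⟨ *-assoc (suc p) (suc p ^ j) p ⟨
    suc p * suc p ^ j * p          ∎
    where
    open ≤-Reasoning
    open +-*-Solver

  -- Bernoulli at j = p. It shows that p summands bring the proportion (p / (p + 1))^p of nonmembers
  -- down to one half.
  2p^p≤[1+p]^p : ∀ p .{{_ : NonZero p}} → 2 * p ^ p ≤ suc p ^ p
  2p^p≤[1+p]^p p = *-cancelʳ-≤ _ _ p (begin
    2 * p ^ p * p     ≡⟨ solve 2 (λ p q → con 2 :* q :* p := q :* (p :+ p)) refl p (p ^ p) ⟩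
    p ^ p * (p + p)   ≤⟨ bernoulli p p ⟩
    suc p ^ p * p     ∎)
    where
    open ≤-Reasoning
    open +-*-Solver

  module _ {D : ℕ → Set} (D? : Decidable D) (D0 : D 0) where

    sumset : ℕ → ℕ → Set
    sumset zero    = _≡ 0
    sumset (suc j) = sumset j ⊕ D

    sumset? : ∀ j → Decidable (sumset j)
    sumset? zero    = _≟ 0
    sumset? (suc j) = sumset? j ⊕? D?

    0∈-sumset : ∀ j → sumset j 0
    0∈-sumset zero    = refl
    0∈-sumset (suc j) = 0 , s≤s z≤n , 0∈-sumset j , D0

    nonmembers-sumset : ∀ p → (∀ n → suc p * nonmembers D? n ≤ p * n) →
      ∀ j n → suc p ^ j * nonmembers (sumset? j) n ≤ p ^ j * n
    nonmembers-sumset p dense zero n = *-monoʳ-≤ 1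
      (≤-trans (m≤n+m _ (members (_≟ 0) n)) (≤-reflexive (members+nonmembers (_≟ 0) n)))
    nonmembers-sumset p dense (suc j) n = begin
      suc p * suc p ^ j * nonmembers (sumset? (suc j)) n
        ≡⟨ solve 3 (λ a b c → a :* b :* c := b :* (a :* c)) refl (suc p) (suc p ^ j) (nonmembers (sumset? (suc j)) n) ⟩
      suc p ^ j * (suc p * nonmembers (sumset? (suc j)) n)
        ≤⟨ *-monoʳ-≤ (suc p ^ j) (nonmembers-⊕ (sumset? j) D? (0∈-sumset j) D0 p dense n) ⟩
      suc p ^ j * (p * nonmembers (sumset? j) n)
        ≡⟨ solve 3 (λ a b c → a :* (b :* c) := b :* (a :* c)) refl (suc p ^ j) p (nonmembers (sumset? j) n) ⟩
      p * (suc p ^ j * nonmembers (sumset? j) n)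
        ≤⟨ *-monoʳ-≤ p (nonmembers-sumset p dense j n) ⟩
      p * (p ^ j * n)
        ≡⟨ *-assoc p (p ^ j) n ⟨
      p * p ^ j * n ∎
      where
      open ≤-Reasoning
      open +-*-Solver

    schnirelmann : ∀ k → (∀ n → n ≤ k * members D? n) →
      ∃[ j ] (1 ≤ j × (∀ n → (sumset j ⊕ sumset j) n))
    schnirelmann k D-dense = p , s≤s z≤n , λ n → half-dense⇒⊕ (sumset? p) (0∈-sumset p) n
      (*-cancelˡ-≤ (p ^ p) {{m^n≢0 p p}} (begin
        p ^ p * (2 * nonmembers (sumset? p) n)  ≡⟨ solve 2 (λ a b → a :* (con 2 :* b) := con 2 :* a :* b) refl (p ^ p) (nonmembers (sumset? p) n) ⟩
        2 * p ^ p * nonmembers (sumset? p) n    ≤⟨ *-monoˡ-≤ (nonmembers (sumset? p) n) (2p^p≤[1+p]^p p) ⟩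
        suc p ^ p * nonmembers (sumset? p) n    ≤⟨ nonmembers-sumset p sparse p n ⟩
        p ^ p * n                              ∎))
      where
      open ≤-Reasoning
      open +-*-Solver
      -- The successor keeps p nonzero, which the halving estimate and the cancellation of `p ^ p`
      -- require, and it makes the number of summands positive.
      p : ℕ
      p = suc k
      sparse : ∀ n → suc p * nonmembers D? n ≤ p * n
      sparse n = +-cancelˡ-≤ n _ _ (begin
        n + suc p * u
          ≤⟨ +-monoˡ-≤ (suc p * u) (D-dense n) ⟩
        k * v + suc p * u
          ≤⟨ +-monoˡ-≤ (suc p * u) (*-monoˡ-≤ v (≤-trans (n≤1+n k) (n≤1+n p))) ⟩
        suc p * v + suc p * u
          ≡⟨ *-distribˡ-+ (suc p) v u ⟨
        suc p * (v + u)
          ≡⟨ cong (suc p *_) (members+nonmembers D? n) ⟩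
        suc p * n ∎)
        where
        u v : ℕ
        u = nonmembers D? n
        v = members D? n

-- Counting functions, representation counts, and the growth of A under dilation.

module Counting where
  open import Data.List.Base as List using (List; []; _∷_; length; filter; upTo)
  import Data.List.Properties as Listₚ
  open import Data.Nat.Base
  open import Data.Nat.Properties
  open import Data.Product.Base using (Σ-syntax; ∃-syntax; _×_; _,_; proj₁; proj₂)
  open import Data.Sum.Base using (inj₁; inj₂)
  open import Data.Vec.Base as Vec using (Vec; []; _∷_)
  import Data.Vec.Properties as Vecₚ
  open import Data.Vec.Relation.Unary.All as All using (All; []; _∷_)
  import Data.Vec.Relation.Unary.All.Properties as Allₚ
  open import Relation.Binary.PropositionalEquality
  open import Relation.Nullary
  open import Relation.Nullary.Negation using (contradiction)
  open import Relation.Unary using (Decidable)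
  open import Defs using (Sequence; term; increasing; _∈_; _∈?_; _⊆_; count; rep; tuples)
  open Schnirelmann using (𝟙)
  open Sums ℕ-orderedSemiring

  length-filter-𝟙 : {A : Set} {P : A → Set} (P? : Decidable P) → ∀ xs →
    length (filter P? xs) ≡ sumList (List.map (λ x → 𝟙 (P? x)) xs)
  length-filter-𝟙 P? [] = refl
  length-filter-𝟙 P? (x ∷ xs) with P? x
  ... | yes _ = cong suc (length-filter-𝟙 P? xs)
  ... | no _  = length-filter-𝟙 P? xs

  χ : Sequence → ℕ → ℕ
  χ 𝒜 n = 𝟙 (n ∈? 𝒜)

  count≡sum : ∀ 𝒜 x → count 𝒜 x ≡ sum (χ 𝒜) (suc x)
  count≡sum 𝒜 x = trans (length-filter-𝟙 (_∈? 𝒜) (upTo (suc x)))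
    (trans (cong sumList (Listₚ.map-upTo (χ 𝒜) (suc x))) (sumList-applyUpTo (χ 𝒜) (suc x)))

  𝟙-all≡prod : ∀ 𝒜 {h} (v : Vec ℕ h) → 𝟙 (All.all? (_∈? 𝒜) v) ≡ prod (χ 𝒜) v
  𝟙-all≡prod 𝒜 []      = refl
  𝟙-all≡prod 𝒜 (k ∷ v) with k ∈? 𝒜 | All.all? (_∈? 𝒜) v | 𝟙-all≡prod 𝒜 v
  ... | yes _ | yes _ | eq = trans eq (sym (+-identityʳ _))
  ... | yes _ | no _  | eq = trans eq (sym (+-identityʳ _))
  ... | no _  | yes _ | _  = refl
  ... | no _  | no _  | _  = refl

  rep≡convPower : ∀ 𝒜 h n → rep 𝒜 h n ≡ convPower (χ 𝒜) h n
  rep≡convPower 𝒜 h n = trans (length-filter-𝟙 (All.all? (_∈? 𝒜)) (tuples h n))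
    (cong sumList (Listₚ.map-cong (𝟙-all≡prod 𝒜) (tuples h n)))

  𝟙-mono : {P Q : Set} → (P → Q) → (p : Dec P) (q : Dec Q) → 𝟙 p ≤ 𝟙 q
  𝟙-mono P⇒Q (no _)  q       = z≤n
  𝟙-mono P⇒Q (yes p) (yes _) = ≤-refl
  𝟙-mono P⇒Q (yes p) (no ¬q) = contradiction (P⇒Q p) ¬q

  rep-mono : ∀ ℬ 𝒜 → ℬ ⊆ 𝒜 → ∀ h n → rep ℬ h n ≤ rep 𝒜 h n
  rep-mono ℬ 𝒜 ℬ⊆𝒜 h n = subst₂ _≤_ (sym (rep≡convPower ℬ h n)) (sym (rep≡convPower 𝒜 h n))
    (convPower-mono {f = χ ℬ} {g = χ 𝒜} (λ _ → z≤n) (λ k → 𝟙-mono (ℬ⊆𝒜 k) (k ∈? ℬ) (k ∈? 𝒜)) h n)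

  Representable : Sequence → ℕ → ℕ → Set
  Representable 𝒜 g n = Σ[ v ∈ Vec ℕ g ] (All (_∈ 𝒜) v × Vec.sum v ≡ n)

  Representable-+ : ∀ {𝒜 g g′ m n} → Representable 𝒜 g m → Representable 𝒜 g′ n →
    Representable 𝒜 (g + g′) (m + n)
  Representable-+ (v , v∈ , refl) (w , w∈ , refl) = v Vec.++ w , Allₚ.++⁺ v∈ w∈ , Vecₚ.sum-++ v

  Representable-∷ : ∀ {𝒜 h k n} → k ∈ 𝒜 → Representable 𝒜 h n → Representable 𝒜 (suc h) (k + n)
  Representable-∷ k∈ (v , v∈ , refl) = _ ∷ v , k∈ ∷ v∈ , refl

  0-Representable : ∀ {𝒜} → 0 ∈ 𝒜 → ∀ h → Representable 𝒜 h 0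
  0-Representable {𝒜} 0∈ zero    = [] , [] , refl
  0-Representable {𝒜} 0∈ (suc h) = Representable-∷ {𝒜} 0∈ (0-Representable {𝒜} 0∈ h)

  sum>0 : ∀ {f} n → 0 < sum f n → ∃[ k ] (k < n × 0 < f k)
  sum>0 {f} (suc n) pos with f 0 in eq
  ... | suc _ = 0 , z<s , subst (0 <_) (sym eq) z<s
  ... | zero  = let k , k<n , fk = sum>0 n pos in suc k , s<s k<n , fk

  convPower>0 : ∀ 𝒜 h n → 0 < convPower (χ 𝒜) h n → Representable 𝒜 h n
  convPower>0 𝒜 zero    zero pos = [] , [] , refl
  convPower>0 𝒜 (suc h) n    pos
    with sum>0 {λ k → χ 𝒜 k * convPower (χ 𝒜) h (n ∸ k)} (suc n)
           (subst (0 <_) (convPower-suc (χ 𝒜) h n) pos)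
  ... | k , s≤s k≤n , pos′ with k ∈? 𝒜
  -- For k outside 𝒜 the factor `χ 𝒜 k` is 0, so `pos′` would be 0 < 0 and that case is empty.
  ... | yes k∈ = subst (Representable 𝒜 (suc h)) (m+[n∸m]≡n k≤n)
    (Representable-∷ {𝒜} k∈ (convPower>0 𝒜 h (n ∸ k) (subst (0 <_) (+-identityʳ _) pos′)))

  rep>0⇒Representable : ∀ 𝒜 h n → 0 < rep 𝒜 h n → Representable 𝒜 h n
  rep>0⇒Representable 𝒜 h n pos = convPower>0 𝒜 h n (subst (0 <_) (rep≡convPower 𝒜 h n) pos)

  ^-≡ : ∀ m n → OrderedSemiring._^_ ℕ-orderedSemiring m n ≡ m ^ n
  ^-≡ m zero    = refl
  ^-≡ m (suc n) = cong (m *_) (^-≡ m n)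

  sum-rep-≤ : ∀ 𝒜 h x → sum (rep 𝒜 h) (suc x) ≤ count 𝒜 x ^ h
  sum-rep-≤ 𝒜 h x = begin
    sum (rep 𝒜 h) (suc x)            ≡⟨ sum-cong (rep≡convPower 𝒜 h) (suc x) ⟩
    sum (convPower (χ 𝒜) h) (suc x)  ≤⟨ sum-convPower-≤ {f = χ 𝒜} (λ _ → z≤n) h (suc x) ⟩
    _                                ≡⟨ ^-≡ (sum (χ 𝒜) (suc x)) h ⟩
    sum (χ 𝒜) (suc x) ^ h            ≡⟨ cong (_^ h) (count≡sum 𝒜 x) ⟨
    count 𝒜 x ^ h                    ∎
    where open ≤-Reasoning

  sum-rep-≥ : ∀ 𝒜 h x → count 𝒜 x ^ h ≤ sum (rep 𝒜 h) (suc (h * x))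
  sum-rep-≥ 𝒜 h x = begin
    count 𝒜 x ^ h                          ≡⟨ cong (_^ h) (count≡sum 𝒜 x) ⟩
    sum (χ 𝒜) (suc x) ^ h                  ≡⟨ ^-≡ (sum (χ 𝒜) (suc x)) h ⟨
    _                                      ≤⟨ sum-convPower-≥ {f = χ 𝒜} (λ _ → z≤n) h x ⟩
    sum (convPower (χ 𝒜) h) (suc (h * x))  ≡⟨ sum-cong (rep≡convPower 𝒜 h) (suc (h * x)) ⟨
    sum (rep 𝒜 h) (suc (h * x))            ∎
    where open ≤-Reasoning

  count-mono : ∀ 𝒜 {x y} → x ≤ y → count 𝒜 x ≤ count 𝒜 y
  count-mono 𝒜 {x} {y} x≤y = subst₂ _≤_ (sym (count≡sum 𝒜 x)) (sym (count≡sum 𝒜 y))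
    (sum-monoʳ {f = χ 𝒜} (λ _ → z≤n) (s≤s x≤y))

  χ≡1 : ∀ {𝒜 n} → n ∈ 𝒜 → χ 𝒜 n ≡ 1
  χ≡1 {𝒜} {n} n∈ with n ∈? 𝒜
  ... | yes _ = refl
  ... | no n∉ = contradiction n∈ n∉

  χ≡0 : ∀ {𝒜 n} → ¬ n ∈ 𝒜 → χ 𝒜 n ≡ 0
  χ≡0 {𝒜} {n} n∉ with n ∈? 𝒜
  ... | yes n∈ = contradiction n∈ n∉
  ... | no _   = refl

  1≤count : ∀ {𝒜} → 0 ∈ 𝒜 → ∀ x → 1 ≤ count 𝒜 x
  1≤count {𝒜} 0∈ x = begin
    1                             ≡⟨ χ≡1 0∈ ⟨
    χ 𝒜 0                         ≤⟨ m≤m+n (χ 𝒜 0) _ ⟩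
    sum (χ 𝒜) (suc x)             ≡⟨ count≡sum 𝒜 x ⟨
    count 𝒜 x                     ∎
    where open ≤-Reasoning

  2≤count : ∀ {𝒜} → 0 ∈ 𝒜 → 1 ∈ 𝒜 → ∀ x → 1 ≤ x → 2 ≤ count 𝒜 x
  2≤count {𝒜} 0∈ 1∈ x 1≤x = begin
    2                             ≡⟨ cong₂ (λ a b → a + (b + 0)) (χ≡1 0∈) (χ≡1 1∈) ⟨
    sum (χ 𝒜) 2                   ≡⟨ count≡sum 𝒜 1 ⟨
    count 𝒜 1                     ≤⟨ count-mono 𝒜 1≤x ⟩
    count 𝒜 x                     ∎
    where open ≤-Reasoning

  module _ (𝒜 : Sequence) where
    term-mono-< : ∀ {i j} → i < j → term 𝒜 i < term 𝒜 j
    term-mono-< {i} {suc j} (s≤s i≤j) with m≤n⇒m<n∨m≡n i≤j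
    ... | inj₁ i<j  = <-trans (term-mono-< i<j) (increasing 𝒜 j)
    ... | inj₂ refl = increasing 𝒜 j

    term-mono-≤ : ∀ {i j} → i ≤ j → term 𝒜 i ≤ term 𝒜 j
    term-mono-≤ i≤j with m≤n⇒m<n∨m≡n i≤j
    ... | inj₁ i<j  = <⇒≤ (term-mono-< i<j)
    ... | inj₂ refl = ≤-refl

    private
      -- Enumeration and counting are adjoint; through this, a bound on terms becomes a bound on
      -- counts. In the induction on m the count moves exactly when m is a term.
      Galois : ℕ → Set
      Galois m = ∀ k → (term 𝒜 k < m → k < sum (χ 𝒜) m) × (k < sum (χ 𝒜) m → term 𝒜 k < m)

      Galois-∈ : ∀ j → Galois (term 𝒜 j) → Galois (suc (term 𝒜 j))
      Galois-∈ j IH k =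
          (λ k< → subst (k <_) (sym sum≡) (s≤s (≮⇒≥ (λ j<k → <⇒≱ (term-mono-< j<k) (s≤s⁻¹ k<)))))
        , (λ k< → s≤s (term-mono-≤ (s≤s⁻¹ (subst (k <_) sum≡ k<))))
        where
        -- The hypothesis taken at j excludes a count above j; taken at the count itself, it
        -- excludes a count below j.
        sum≡j : sum (χ 𝒜) (term 𝒜 j) ≡ j
        sum≡j = ≤-antisym
          (≮⇒≥ (λ j< → <-irrefl refl (proj₂ (IH j) j<)))
          (≮⇒≥ (λ s<j → <-irrefl refl (proj₁ (IH _) (term-mono-< s<j))))
        sum≡ : sum (χ 𝒜) (suc (term 𝒜 j)) ≡ suc j
        sum≡ = trans (sum-∷ʳ (χ 𝒜) (term 𝒜 j))
          (trans (cong₂ _+_ sum≡j (χ≡1 {𝒜} (j , refl))) (+-comm j 1))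

      Galois-∉ : ∀ m → ¬ m ∈ 𝒜 → Galois m → Galois (suc m)
      Galois-∉ m m∉ IH k =
          (λ k< → subst (k <_) (sym sum≡) (proj₁ (IH k) (≤∧≢⇒< (s≤s⁻¹ k<) (λ k≡ → m∉ (k , k≡)))))
        , (λ k< → m<n⇒m<1+n (proj₂ (IH k) (subst (k <_) sum≡ k<)))
        where
        sum≡ : sum (χ 𝒜) (suc m) ≡ sum (χ 𝒜) m
        sum≡ = trans (sum-∷ʳ (χ 𝒜) m)
          (trans (cong (sum (χ 𝒜) m +_) (χ≡0 {𝒜} m∉)) (+-identityʳ _))

      Galois-suc : ∀ m → Dec (m ∈ 𝒜) → Galois m → Galois (suc m)
      Galois-suc m (yes (j , refl)) = Galois-∈ j
      Galois-suc m (no m∉)          = Galois-∉ m m∉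

    term<⇔<sum : ∀ m k → (term 𝒜 k < m → k < sum (χ 𝒜) m) × (k < sum (χ 𝒜) m → term 𝒜 k < m)
    term<⇔<sum zero    k = (λ ()) , (λ ())
    term<⇔<sum (suc m)   = Galois-suc m (m ∈? 𝒜) (term<⇔<sum m)

    term≤⇒<count : ∀ {k x} → term 𝒜 k ≤ x → k < count 𝒜 x
    term≤⇒<count {k} {x} le = subst (k <_) (sym (count≡sum 𝒜 x)) (proj₁ (term<⇔<sum (suc x) k) (s≤s le))

    <count⇒term≤ : ∀ {k x} → k < count 𝒜 x → term 𝒜 k ≤ x
    <count⇒term≤ {k} {x} k< = s≤s⁻¹ (proj₂ (term<⇔<sum (suc x) k) (subst (k <_) (count≡sum 𝒜 x) k<))

    -- If A(x) = m + 1, then a_m ≤ x, hence a_{4m} ≤ K² x and A(K² x) > 4m. A single doubling would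
    -- only give 2m + 1 elements, one short of 2(m + 1). With two doublings m ≥ 1 suffices, and 0, 1
    -- ∈ 𝒜 provides it.
    count-dilate : 0 ∈ 𝒜 → 1 ∈ 𝒜 → ∀ K → (∀ n → term 𝒜 (2 * n) ≤ K * term 𝒜 n) →
      ∀ x → 1 ≤ x → 2 * count 𝒜 x ≤ count 𝒜 (K * K * x)
    count-dilate 0∈ 1∈ K doubling x 1≤x = go (count 𝒜 x) refl (2≤count 0∈ 1∈ x 1≤x)
      where
      open ≤-Reasoning
      go : ∀ c → c ≡ count 𝒜 x → 2 ≤ c → 2 * c ≤ count 𝒜 (K * K * x)
      go (suc m) eq (s≤s 1≤m) = begin
        2 * suc m              ≡⟨ *-suc 2 m ⟩
        2 + 2 * m              ≤⟨ +-monoˡ-≤ (2 * m) (*-monoʳ-≤ 2 1≤m) ⟩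
        2 * m + 2 * m          ≡⟨ cong (2 * m +_) (+-identityʳ (2 * m)) ⟨
        2 * (2 * m)            ≤⟨ <⇒≤ (term≤⇒<count bound) ⟩
        count 𝒜 (K * K * x)    ∎
        where
        bound : term 𝒜 (2 * (2 * m)) ≤ K * K * x
        bound = begin
          term 𝒜 (2 * (2 * m))    ≤⟨ doubling (2 * m) ⟩
          K * term 𝒜 (2 * m)      ≤⟨ *-monoʳ-≤ K (doubling m) ⟩
          K * (K * term 𝒜 m)      ≡⟨ *-assoc K K (term 𝒜 m) ⟨
          K * K * term 𝒜 m        ≤⟨ *-monoʳ-≤ (K * K) (<count⇒term≤ (subst (m <_) eq ≤-refl)) ⟩
          K * K * x               ∎

  ^-distribʳ-* : ∀ o m n → (m * n) ^ o ≡ m ^ o * n ^ o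
  ^-distribʳ-* zero    m n = refl
  ^-distribʳ-* (suc o) m n = trans (cong (m * n *_) (^-distribʳ-* o m n))
    ([m*n]*[o*p]≡[m*o]*[n*p] m n (m ^ o) (n ^ o))

  n≤2^n : ∀ n → n ≤ 2 ^ n
  n≤2^n zero    = z≤n
  n≤2^n (suc n) = begin
    suc n            ≤⟨ +-mono-≤ (m^n>0 2 n) (n≤2^n n) ⟩
    2 ^ n + 2 ^ n    ≡⟨ cong (2 ^ n +_) (+-identityʳ (2 ^ n)) ⟨
    2 * 2 ^ n        ∎
    where open ≤-Reasoning

  module _ (c : ℕ → ℕ) where
    iterate-dilate : ∀ Q .{{_ : NonZero Q}} → (∀ x → 1 ≤ x → 2 * c x ≤ c (Q * x)) →
      ∀ j x → 1 ≤ x → 2 ^ j * c x ≤ c (Q ^ j * x)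
    iterate-dilate Q dilate zero    x 1≤x = ≤-reflexive (trans (+-identityʳ _) (cong c (sym (+-identityʳ x))))
    iterate-dilate Q dilate (suc j) x 1≤x = begin
      2 * 2 ^ j * c x       ≡⟨ *-assoc 2 (2 ^ j) (c x) ⟩
      2 * (2 ^ j * c x)     ≤⟨ *-monoʳ-≤ 2 (iterate-dilate Q dilate j x 1≤x) ⟩
      2 * c (Q ^ j * x)     ≤⟨ dilate (Q ^ j * x) (*-mono-≤ (m^n>0 Q j) 1≤x) ⟩
      c (Q * (Q ^ j * x))   ≡⟨ cong c (*-assoc Q (Q ^ j) x) ⟨
      c (Q * Q ^ j * x)     ∎
      where open ≤-Reasoning

    iterate-doubling : ∀ K → (∀ x → c (2 * x) ≤ K * c x) → ∀ j x → c (2 ^ j * x) ≤ K ^ j * c x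
    iterate-doubling K doubling zero    x = ≤-reflexive (trans (cong c (+-identityʳ x)) (sym (+-identityʳ _)))
    iterate-doubling K doubling (suc j) x = begin
      c (2 * 2 ^ j * x)     ≡⟨ cong c (*-assoc 2 (2 ^ j) x) ⟩
      c (2 * (2 ^ j * x))   ≤⟨ doubling (2 ^ j * x) ⟩
      K * c (2 ^ j * x)     ≤⟨ *-monoʳ-≤ K (iterate-doubling K doubling j x) ⟩
      K * (K ^ j * c x)     ≡⟨ *-assoc K (K ^ j) (c x) ⟨
      K * K ^ j * c x       ∎
      where open ≤-Reasoning

-- Natural numbers inside the rationals.

module Rationals where
  open import Data.Integer.Base as ℤ using (+_)
  import Data.Integer.Properties as ℤₚ
  open import Data.Nat.Base as ℕ using (ℕ; suc)
  import Data.Nat.Properties as ℕₚ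
  open import Data.Rational.Base
  open import Data.Rational.Properties
  open import Data.Rational.Unnormalised.Base as ℚᵘ using (mkℚᵘ)
  import Data.Rational.Unnormalised.Properties as ℚᵘₚ
  open import Relation.Binary.PropositionalEquality

  -- Opaque, as otherwise type checking unfolds the gcd computation behind _/_.
  opaque
    ι : ℕ → ℚ
    ι n = + n / 1

    ι≡/ : ∀ n → ι n ≡ + n / 1
    ι≡/ n = refl

  toℚᵘ-/ : ∀ n d → toℚᵘ (+ n / suc d) ℚᵘ.≃ mkℚᵘ (+ n) d
  toℚᵘ-/ n d = toℚᵘ-fromℚᵘ (mkℚᵘ (+ n) d)

  opaque
    unfolding ι

    ι-+ : ∀ m n → ι (m ℕ.+ n) ≡ ι m + ι n
    ι-+ m n = toℚᵘ-injective (begin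
      toℚᵘ (ι (m ℕ.+ n))                 ≈⟨ toℚᵘ-/ (m ℕ.+ n) 0 ⟩
      mkℚᵘ (+ (m ℕ.+ n)) 0               ≈⟨ ℚᵘ.*≡* (cong₂ (λ a b → (a ℤ.+ b) ℤ.* + 1) (sym (ℤₚ.*-identityʳ (+ m))) (sym (ℤₚ.*-identityʳ (+ n)))) ⟩
      mkℚᵘ (+ m) 0 ℚᵘ.+ mkℚᵘ (+ n) 0     ≈⟨ ℚᵘₚ.+-cong (toℚᵘ-/ m 0) (toℚᵘ-/ n 0) ⟨
      toℚᵘ (ι m) ℚᵘ.+ toℚᵘ (ι n)         ≈⟨ toℚᵘ-homo-+ (ι m) (ι n) ⟨
      toℚᵘ (ι m + ι n)                   ∎)
      where open ℚᵘₚ.≃-Reasoning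

    ι-* : ∀ m n → ι (m ℕ.* n) ≡ ι m * ι n
    ι-* m n = toℚᵘ-injective (begin
      toℚᵘ (ι (m ℕ.* n))                 ≈⟨ toℚᵘ-/ (m ℕ.* n) 0 ⟩
      mkℚᵘ (+ (m ℕ.* n)) 0               ≈⟨ ℚᵘ.*≡* (cong (ℤ._* + 1) (ℤₚ.pos-* m n)) ⟩
      mkℚᵘ (+ m) 0 ℚᵘ.* mkℚᵘ (+ n) 0     ≈⟨ ℚᵘₚ.*-cong (toℚᵘ-/ m 0) (toℚᵘ-/ n 0) ⟨
      toℚᵘ (ι m) ℚᵘ.* toℚᵘ (ι n)         ≈⟨ toℚᵘ-homo-* (ι m) (ι n) ⟨
      toℚᵘ (ι m * ι n)                   ∎)
      where open ℚᵘₚ.≃-Reasoning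

    ι-mono : ∀ {m n} → m ℕ.≤ n → ι m ≤ ι n
    ι-mono {m} {n} m≤n = toℚᵘ-cancel-≤
      (ℚᵘₚ.≤-respʳ-≃ (ℚᵘₚ.≃-sym (toℚᵘ-/ n 0)) (ℚᵘₚ.≤-respˡ-≃ (ℚᵘₚ.≃-sym (toℚᵘ-/ m 0))
        (ℚᵘ.*≤* (ℤₚ.*-monoʳ-≤-nonNeg (+ 1) (ℤ.+≤+ m≤n)))))

    ι-cancel : ∀ {m n} → ι m ≤ ι n → m ℕ.≤ n
    ι-cancel {m} {n} le with ℚᵘₚ.≤-respʳ-≃ (toℚᵘ-/ n 0) (ℚᵘₚ.≤-respˡ-≃ (toℚᵘ-/ m 0) (toℚᵘ-mono-≤ le))
    ... | ℚᵘ.*≤* le′ = ℤₚ.drop‿+≤+ (ℤₚ.*-cancelʳ-≤-pos (+ m) (+ n) (+ 1) le′)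

    ι*/ : ∀ n d → ι (suc d) * (+ n / suc d) ≡ ι n
    ι*/ n d = toℚᵘ-injective (begin
      toℚᵘ (ι (suc d) * (+ n / suc d))            ≈⟨ toℚᵘ-homo-* (ι (suc d)) (+ n / suc d) ⟩
      toℚᵘ (ι (suc d)) ℚᵘ.* toℚᵘ (+ n / suc d)    ≈⟨ ℚᵘₚ.*-cong (toℚᵘ-/ (suc d) 0) (toℚᵘ-/ n d) ⟩
      mkℚᵘ (+ suc d) 0 ℚᵘ.* mkℚᵘ (+ n) d          ≈⟨ ℚᵘ.*≡* cross ⟩
      mkℚᵘ (+ n) 0                                ≈⟨ toℚᵘ-/ n 0 ⟨
      toℚᵘ (ι n)                                  ∎)
      where
      open ℚᵘₚ.≃-Reasoning
      cross : (+ suc d ℤ.* + n) ℤ.* + 1 ≡ + n ℤ.* (+ (1 ℕ.* suc d))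
      cross = trans (ℤₚ.*-identityʳ _) (trans (ℤₚ.*-comm (+ suc d) (+ n))
        (cong (λ e → + n ℤ.* + e) (sym (ℕₚ.+-identityʳ (suc d)))))

    ι-pos : ∀ n → Positive (ι (suc n))
    ι-pos n = normalize-pos (suc n) 1

    ι-0 : ι 0 ≡ 0ℚ
    ι-0 = refl

    ι-1 : ι 1 ≡ 1ℚ
    ι-1 = refl

  ι-suc : ∀ n → ι (suc n) ≡ ι n + 1ℚ
  ι-suc n = trans (ι-+ 1 n) (trans (+-comm (ι 1) (ι n)) (cong (λ e → ι n + e) ι-1))

  0≤ι : ∀ n → 0ℚ ≤ ι n
  0≤ι n = ≤-trans (≤-reflexive (sym ι-0)) (ι-mono ℕ.z≤n)

  0≤/ : ∀ n d → 0ℚ ≤ + n / suc d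
  0≤/ n d = nonNegative⁻¹ (+ n / suc d) {{normalize-nonNeg n (suc d)}}

  *-monoˡ : ∀ {p q r} → 0ℚ ≤ r → p ≤ q → r * p ≤ r * q
  *-monoˡ {r = r} 0≤r = *-monoˡ-≤-nonNeg r {{nonNegative 0≤r}}

  ℚ-orderedSemiring : OrderedSemiring
  ℚ-orderedSemiring = record
    { isCommutativeSemiring = isCommutativeSemiring
    ; _≤_       = _≤_
    ; ≤-refl    = ≤-refl
    ; ≤-trans   = ≤-trans
    ; +-mono-≤  = +-mono-≤
    ; *-monoˡ-≤ = *-monoˡ
    ; 0≤1       = nonNegative⁻¹ 1ℚ
    }
    where open import Algebra.Bundles using (CommutativeRing)
          open CommutativeRing +-*-commutativeRing using (isCommutativeSemiring)

-- The upper bound (n + 1) J(n) ≪ A(n)ʰ.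

module SingularIntegral where
  open import Data.Integer.Base using (+_)
  open import Data.Nat.Base
  open import Data.Nat.DivMod using (_/_; m/n≤m; m/n<m; m/n*n≤m; m≡m%n+[m/n]*n; m%n<n)
  open import Data.Nat.Induction using (<-rec)
  open import Data.Nat.Properties
  open import Data.Nat.Solver renaming (module +-*-Solver to ℕ-Solver) using ()
  open import Data.Rational.Base as ℚ using (ℚ; 0ℚ; 1ℚ)
  import Data.Rational.Properties as ℚₚ
  open import Data.Rational.Solver renaming (module +-*-Solver to ℚ-Solver) using ()
  open import Relation.Binary.PropositionalEquality
  open Rationals
  open Counting using (^-distribʳ-*)
  open Sums ℚ-orderedSemiring

  module Bound (c : ℕ → ℕ) (c-mono : ∀ {x y} → x ≤ y → c x ≤ c y)
               (Q : ℕ) (2≤Q : 2 ≤ Q) (dilate : ∀ x → 1 ≤ x → 2 * c x ≤ c (Q * x)) where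
    instance
      Q≢0 : NonZero Q
      Q≢0 = >-nonZero (≤-trans (s≤s z≤n) 2≤Q)

    w : ℕ → ℚ
    w k = + c k ℚ./ suc k

    0≤w : ∀ k → 0ℚ ℚ.≤ w k
    0≤w k = 0≤/ (c k) k

    ι*w : ∀ k → ι (suc k) ℚ.* w k ≡ ι (c k)
    ι*w k = ι*/ (c k) k

    sum-const : ∀ x n → sum (λ _ → ι x) n ≡ ι (n * x)
    sum-const x zero    = sym ι-0
    sum-const x (suc n) = trans (cong (ι x ℚ.+_) (sum-const x n)) (sym (ι-+ x (n * x)))

    -- Each of the d terms is at most c n / (m + 1).
    sum-block : ∀ m d n → m + d ≤ n → d ≤ Q * suc m → sum (λ j → w (suc m + j)) d ℚ.≤ ι (Q * c n)
    sum-block m d n m+d≤n d≤ = ℚₚ.*-cancelˡ-≤-pos (ι (suc m)) {{ι-pos m}} (begin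
      ι (suc m) ℚ.* sum (λ j → w (suc m + j)) d       ≡⟨ sum-*ˡ (ι (suc m)) (λ j → w (suc m + j)) d ⟨
      sum (λ j → ι (suc m) ℚ.* w (suc m + j)) d       ≤⟨ sum-mono d term≤ ⟩
      sum (λ _ → ι (c n)) d                           ≡⟨ sum-const (c n) d ⟩
      ι (d * c n)                                     ≤⟨ ι-mono {d * c n} (*-monoˡ-≤ (c n) d≤) ⟩
      ι (Q * suc m * c n)                             ≡⟨ cong ι (solve 3 (λ q m c → q :* m :* c := m :* (q :* c)) refl Q (suc m) (c n)) ⟩
      ι (suc m * (Q * c n))                           ≡⟨ ι-* (suc m) (Q * c n) ⟩
      ι (suc m) ℚ.* ι (Q * c n)                       ∎)
      where
      open ℚₚ.≤-Reasoning
      open ℕ-Solver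
      term≤ : ∀ j → j < d → ι (suc m) ℚ.* w (suc m + j) ℚ.≤ ι (c n)
      term≤ j j<d = begin
        ι (suc m) ℚ.* w (suc m + j)          ≤⟨ ℚₚ.*-monoʳ-≤-nonNeg (w (suc m + j)) {{ℚ.nonNegative (0≤w (suc m + j))}}
                                                  (ι-mono {suc m} {suc (suc m + j)} (s≤s (≤-trans (m≤m+n m j) (n≤1+n (m + j))))) ⟩
        ι (suc (suc m + j)) ℚ.* w (suc m + j) ≡⟨ ι*w (suc m + j) ⟩
        ι (c (suc m + j))                    ≤⟨ ι-mono {c (suc m + j)} (c-mono (≤-trans (≤-reflexive (sym (+-suc m j))) (≤-trans (+-monoʳ-≤ m j<d) m+d≤n))) ⟩
        ι (c n)                              ∎

    -- The part k ≤ n / Q of the sum is at most half of the bound, because c doubles from n / Q to n.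
    sum-w-≤ : ∀ n → sum w (suc n) ℚ.≤ ι (2 * Q * c n)
    sum-w-≤ = <-rec _ step
      where
      step : ∀ n → (∀ {m} → m < n → sum w (suc m) ℚ.≤ ι (2 * Q * c m)) → sum w (suc n) ℚ.≤ ι (2 * Q * c n)
      step n IH = begin
        sum w (suc n)
          ≡⟨ cong (λ k → sum w (suc k)) (m+[n∸m]≡n m≤n) ⟨
        sum w (suc m + d)
          ≡⟨ sum-++ w (suc m) d ⟩
        sum w (suc m) ℚ.+ sum (λ j → w (suc m + j)) d
          ≤⟨ ℚₚ.+-mono-≤ (head m refl) (sum-block m d n (≤-reflexive (m+[n∸m]≡n m≤n)) (≤-trans (m∸n≤m n m) n≤)) ⟩
        ι (Q * c n) ℚ.+ ι (Q * c n)
          ≡⟨ ι-+ (Q * c n) (Q * c n) ⟨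
        ι (Q * c n + Q * c n)
          ≡⟨ cong ι (solve 2 (λ q c → q :* c :+ q :* c := con 2 :* q :* c) refl Q (c n)) ⟩
        ι (2 * Q * c n) ∎
        where
        open ℚₚ.≤-Reasoning
        open ℕ-Solver
        m d : ℕ
        m = n / Q
        d = n ∸ m
        m≤n : m ≤ n
        m≤n = m/n≤m n Q
        n≤ : n ≤ Q * suc m
        n≤ = ≤-trans (≤-reflexive (m≡m%n+[m/n]*n n Q)) (≤-trans (+-monoˡ-≤ (m * Q) (<⇒≤ (m%n<n n Q)))
          (≤-reflexive (*-comm (suc m) Q)))
        -- The quotient n / Q is made a variable so that it can be split: the dilation inequality
        -- starts at 1, and only a positive quotient shows that n > 0, hence n / Q < n.
        head : ∀ k → k ≡ m → sum w (suc k) ℚ.≤ ι (Q * c n)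
        head zero    eq = begin
          w 0 ℚ.+ 0ℚ     ≡⟨ ℚₚ.+-identityʳ (w 0) ⟩
          w 0            ≡⟨ ι≡/ (c 0) ⟨
          ι (c 0)        ≤⟨ ι-mono {c 0} (≤-trans (c-mono z≤n) (m≤n*m (c n) Q)) ⟩
          ι (Q * c n)    ∎
        head (suc k) eq = begin
          sum w (suc (suc k))      ≤⟨ IH (subst (_< n) (sym eq) m<n) ⟩
          ι (2 * Q * c (suc k))    ≤⟨ ι-mono {2 * Q * c (suc k)} (≤-trans
               (≤-reflexive (solve 2 (λ q c → con 2 :* q :* c := q :* (con 2 :* c)) refl Q (c (suc k))))
               (*-monoʳ-≤ Q (≤-trans (dilate (suc k) (s≤s z≤n)) (c-mono Qk≤n)))) ⟩
          ι (Q * c n)              ∎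
          where
          Qk≤n : Q * suc k ≤ n
          Qk≤n = subst (_≤ n) (trans (cong (_* Q) (sym eq)) (*-comm (suc k) Q)) (m/n*n≤m n Q)
          0<n : 0 < n
          0<n = ≤-trans (s≤s z≤n) (subst (_≤ n) (sym eq) m≤n)
          m<n : m < n
          m<n = m/n<m n Q {{>-nonZero 0<n}} 2≤Q

    ^-ι : ∀ {x} y h → 0ℚ ℚ.≤ x → x ℚ.≤ ι y → OrderedSemiring._^_ ℚ-orderedSemiring x h ℚ.≤ ι (y ^ h)
    ^-ι y zero    0≤x x≤ = ℚₚ.≤-reflexive (sym ι-1)
    ^-ι {x} y (suc h) 0≤x x≤ = begin
      x ℚ.* _          ≤⟨ *-monoˡ 0≤x (^-ι y h 0≤x x≤) ⟩
      x ℚ.* ι (y ^ h)  ≤⟨ ℚₚ.*-monoʳ-≤-nonNeg (ι (y ^ h)) {{ℚ.nonNegative (0≤ι (y ^ h))}} x≤ ⟩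
      ι y ℚ.* ι (y ^ h) ≡⟨ ι-* y (y ^ h) ⟨
      ι (y * y ^ h)    ∎
      where open ℚₚ.≤-Reasoning

    private
      rearrange : ∀ a b x y → (a ℚ.+ b) ℚ.* (x ℚ.* y) ≡ a ℚ.* x ℚ.* y ℚ.+ x ℚ.* (b ℚ.* y)
      rearrange = solve 4 (λ a b x y → (a :+ b) :* (x :* y) := a :* x :* y :+ x :* (b :* y)) refl
        where open ℚ-Solver

    -- The summands correspond to the two halves of the split of n + 1. The first, (2Q)ʰ, bounds the
    -- total mass of the h-fold convolution relative to A(n)ʰ. In the second, 2Q bounds the sum of
    -- `w` relative to A(n), and `J-const h` comes from the induction.
    J-const : ℕ → ℕ
    J-const zero    = 1
    J-const (suc h) = (2 * Q) ^ h + 2 * Q * J-const h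

    -- n + 1 ≤ (k + 1) + (n − k + 1) distributes the factor n + 1 over the two factors of the convolution.
    convPower-w-≤ : ∀ h n → ι (suc n) ℚ.* convPower w h n ℚ.≤ ι (J-const h * c n ^ h)
    convPower-w-≤ zero zero    = ℚₚ.≤-reflexive (trans (cong (ℚ._* (1ℚ ℚ.+ 0ℚ)) ι-1) (sym ι-1))
    convPower-w-≤ zero (suc n) = ℚₚ.≤-trans (ℚₚ.≤-reflexive (ℚₚ.*-zeroʳ (ι (suc (suc n))))) (0≤ι 1)
    convPower-w-≤ (suc h) n = begin
      ι (suc n) ℚ.* convPower w (suc h) n
        ≡⟨ cong (ι (suc n) ℚ.*_) (convPower-suc w h n) ⟩
      ι (suc n) ℚ.* sum (λ k → w k ℚ.* T (n ∸ k)) (suc n)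
        ≡⟨ sum-*ˡ (ι (suc n)) (λ k → w k ℚ.* T (n ∸ k)) (suc n) ⟨
      sum (λ k → ι (suc n) ℚ.* (w k ℚ.* T (n ∸ k))) (suc n)
        ≤⟨ sum-mono (suc n) split ⟩
      sum (λ k → ι (c n) ℚ.* T (n ∸ k) ℚ.+ w k ℚ.* b) (suc n)
        ≡⟨ sum-+ (λ k → ι (c n) ℚ.* T (n ∸ k)) (λ k → w k ℚ.* b) (suc n) ⟩
      sum (λ k → ι (c n) ℚ.* T (n ∸ k)) (suc n) ℚ.+ sum (λ k → w k ℚ.* b) (suc n)
        ≡⟨ cong₂ ℚ._+_ (sum-*ˡ (ι (c n)) (λ k → T (n ∸ k)) (suc n)) (sum-*ʳ b w (suc n)) ⟩
      ι (c n) ℚ.* sum (λ k → T (n ∸ k)) (suc n) ℚ.+ sum w (suc n) ℚ.* b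
        ≡⟨ cong (λ s → ι (c n) ℚ.* s ℚ.+ sum w (suc n) ℚ.* b) (sum-reverse T (suc n)) ⟩
      ι (c n) ℚ.* sum T (suc n) ℚ.+ sum w (suc n) ℚ.* b
        ≤⟨ ℚₚ.+-mono-≤
             (*-monoˡ (0≤ι (c n)) (ℚₚ.≤-trans (sum-convPower-≤ 0≤w h (suc n))
               (^-ι (2 * Q * c n) h (sum-nonneg 0≤w (suc n)) (sum-w-≤ n))))
             (ℚₚ.*-monoʳ-≤-nonNeg b {{ℚ.nonNegative (0≤ι (J-const h * c n ^ h))}} (sum-w-≤ n)) ⟩
      ι (c n) ℚ.* ι ((2 * Q * c n) ^ h) ℚ.+ ι (2 * Q * c n) ℚ.* b
        ≡⟨ cong₂ ℚ._+_ (ι-* (c n) ((2 * Q * c n) ^ h)) (ι-* (2 * Q * c n) (J-const h * c n ^ h)) ⟨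
      ι (c n * (2 * Q * c n) ^ h) ℚ.+ ι (2 * Q * c n * (J-const h * c n ^ h))
        ≡⟨ ι-+ (c n * (2 * Q * c n) ^ h) (2 * Q * c n * (J-const h * c n ^ h)) ⟨
      ι (c n * (2 * Q * c n) ^ h + 2 * Q * c n * (J-const h * c n ^ h))
        ≡⟨ cong (λ e → ι (c n * e + 2 * Q * c n * (J-const h * c n ^ h))) (^-distribʳ-* h (2 * Q) (c n)) ⟩
      ι (c n * ((2 * Q) ^ h * c n ^ h) + 2 * Q * c n * (J-const h * c n ^ h))
        ≡⟨ cong ι (solve 5 (λ a q e d j → a :* (e :* d) :+ q :* a :* (j :* d) := (e :+ q :* j) :* (a :* d))
             refl (c n) (2 * Q) ((2 * Q) ^ h) (c n ^ h) (J-const h)) ⟩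
      ι (J-const (suc h) * (c n * c n ^ h)) ∎
      where
      open ℚₚ.≤-Reasoning
      open ℕ-Solver
      T : ℕ → ℚ
      T = convPower w h
      0≤T : ∀ k → 0ℚ ℚ.≤ T k
      0≤T = convPower-nonneg 0≤w h
      b : ℚ
      b = ι (J-const h * c n ^ h)
      split : ∀ k → k < suc n →
        ι (suc n) ℚ.* (w k ℚ.* T (n ∸ k)) ℚ.≤ ι (c n) ℚ.* T (n ∸ k) ℚ.+ w k ℚ.* b
      split k (s≤s k≤n) = begin
        ι (suc n) ℚ.* (w k ℚ.* t)
          ≤⟨ ℚₚ.*-monoʳ-≤-nonNeg (w k ℚ.* t) {{ℚ.nonNegative 0≤wt}} (ι-mono {suc n} {suc k + suc l}
               (s≤s (≤-trans (≤-reflexive (sym (m+[n∸m]≡n k≤n))) (+-monoʳ-≤ k (n≤1+n l))))) ⟩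
        ι (suc k + suc l) ℚ.* (w k ℚ.* t)
          ≡⟨ cong (ℚ._* (w k ℚ.* t)) (ι-+ (suc k) (suc l)) ⟩
        (ι (suc k) ℚ.+ ι (suc l)) ℚ.* (w k ℚ.* t)
          ≡⟨ rearrange (ι (suc k)) (ι (suc l)) (w k) t ⟩
        ι (suc k) ℚ.* w k ℚ.* t ℚ.+ w k ℚ.* (ι (suc l) ℚ.* t)
          ≡⟨ cong (λ x → x ℚ.* t ℚ.+ w k ℚ.* (ι (suc l) ℚ.* t)) (ι*w k) ⟩
        ι (c k) ℚ.* t ℚ.+ w k ℚ.* (ι (suc l) ℚ.* t)
          ≤⟨ ℚₚ.+-mono-≤
               (ℚₚ.*-monoʳ-≤-nonNeg t {{ℚ.nonNegative (0≤T l)}} (ι-mono {c k} (c-mono k≤n)))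
               (*-monoˡ (0≤w k) (ℚₚ.≤-trans (convPower-w-≤ h l)
                 (ι-mono {J-const h * c l ^ h} (*-monoʳ-≤ (J-const h) (^-monoˡ-≤ h (c-mono (m∸n≤m n k))))))) ⟩
        ι (c n) ℚ.* t ℚ.+ w k ℚ.* b ∎
        where
        l : ℕ
        l = n ∸ k
        t : ℚ
        t = T l
        0≤wt : 0ℚ ℚ.≤ w k ℚ.* t
        0≤wt = ℚₚ.≤-trans (ℚₚ.≤-reflexive (sym (ℚₚ.*-zeroʳ (w k)))) (*-monoˡ (0≤w k) (0≤T l))

-- From inequalities between reals to inequalities between natural numbers.

module Approximation where
  open import Data.Integer.Base using (+_; -[1+_])
  open import Data.Nat.Base as ℕ using (ℕ; zero; suc)
  import Data.Nat.Properties as ℕₚ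
  open import Data.Product.Base using (∃-syntax; _×_; _,_)
  open import Data.Rational.Base
  open import Data.Rational.Properties
  open import Data.Rational.Solver using (module +-*-Solver)
  open import Data.Sum.Base using (inj₁; inj₂)
  open import Relation.Binary.PropositionalEquality
  open import Relation.Nullary using (yes; no)
  open import Defs using (approx; isCauchy; fromℕ; 0ℝ; _=O_)
  open Rationals
  open Sums ℕ-orderedSemiring using (sum)

  +-cancelʳ-≤ : ∀ r {p q} → p + r ≤ q + r → p ≤ q
  +-cancelʳ-≤ r {p} {q} p+r≤q+r = subst₂ _≤_ (drop p) (drop q) (+-monoˡ-≤ (- r) p+r≤q+r)
    where
    open +-*-Solver
    drop : ∀ p → p + r - r ≡ p
    drop p = solve 2 (λ p r → p :+ r :- r := p) refl p r

  p≤∣p∣ : ∀ p → p ≤ ∣ p ∣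
  p≤∣p∣ p with ≤-total 0ℚ p
  ... | inj₁ 0≤p = ≤-reflexive (sym (0≤p⇒∣p∣≡p 0≤p))
  ... | inj₂ p≤0 = ≤-trans p≤0 (0≤∣p∣ p)

  ∣p∣≤∣q∣+r : ∀ p q {r} → ∣ p - q ∣ ≤ r → ∣ p ∣ ≤ ∣ q ∣ + r
  ∣p∣≤∣q∣+r p q {r} close = begin
    ∣ p ∣               ≡⟨ cong ∣_∣ (solve 2 (λ p q → p := q :+ (p :- q)) refl p q) ⟩
    ∣ q + (p - q) ∣     ≤⟨ ∣p+q∣≤∣p∣+∣q∣ q (p - q) ⟩
    ∣ q ∣ + ∣ p - q ∣   ≤⟨ +-monoʳ-≤ ∣ q ∣ close ⟩
    ∣ q ∣ + r           ∎
    where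
    open ≤-Reasoning
    open +-*-Solver

  p≤q+r : ∀ p q {r} → ∣ p - q ∣ ≤ r → p ≤ q + r
  p≤q+r p q {r} close = begin
    p             ≡⟨ solve 2 (λ p q → p := q :+ (p :- q)) refl p q ⟩
    q + (p - q)   ≤⟨ +-monoʳ-≤ q (≤-trans (p≤∣p∣ (p - q)) close) ⟩
    q + r         ∎
    where
    open ≤-Reasoning
    open +-*-Solver

  ι-natBound : ∀ p → 0ℚ ≤ p → ∃[ k ] p ≤ ι k
  ι-natBound p@(mkℚ (+ n) d _) 0≤p = n , (begin
    p                            ≡⟨ *-identityˡ p ⟨
    1ℚ * p                       ≤⟨ *-monoʳ-≤-nonNeg p {{nonNegative 0≤p}} (≤-trans (≤-reflexive (sym ι-1)) (ι-mono (ℕ.s≤s ℕ.z≤n))) ⟩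
    ι (suc d) * p                ≡⟨ cong (ι (suc d) *_) (↥p/↧p≡p p) ⟨
    ι (suc d) * (+ n / suc d)    ≡⟨ ι*/ n d ⟩
    ι n                          ∎)
    where open ≤-Reasoning
  ι-natBound (mkℚ -[1+ n ] d _) (*≤* ())

  natCeiling : ∀ p → 0ℚ ≤ p → ∃[ k ] (p ≤ ι k × ι k ≤ p + 1ℚ)
  natCeiling p 0≤p = let K , p≤K = ι-natBound p 0≤p in descend K p≤K
    where
    descend : ∀ K → p ≤ ι K → ∃[ k ] (p ≤ ι k × ι k ≤ p + 1ℚ)
    descend zero    p≤ = 0 , p≤ , ≤-trans (≤-reflexive ι-0) (+-mono-≤ 0≤p (nonNegative⁻¹ 1ℚ))
    descend (suc K) p≤ with p ≤? ι K
    ... | yes p≤K = descend K p≤K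
    ... | no p≰K  = suc K , p≤ , (begin
      ι (suc K)   ≡⟨ ι-suc K ⟩
      ι K + 1ℚ    ≤⟨ +-monoˡ-≤ 1ℚ (<⇒≤ (≰⇒> p≰K)) ⟩
      p + 1ℚ      ∎)
      where open ≤-Reasoning

  -- Serves both for late indices of approximating sequences and for large arguments of an
  -- asymptotic relation.
  Eventually : (ℕ → Set) → Set
  Eventually P = ∃[ N ] (∀ i → N ℕ.≤ i → P i)

  infixr 4 _∧_
  _∧_ : {P Q : ℕ → Set} → Eventually P → Eventually Q → Eventually (λ i → P i × Q i)
  (M , p) ∧ (N , q) = M ℕ.⊔ N , λ i le →
    p i (ℕₚ.m⊔n≤o⇒m≤o M N le) , q i (ℕₚ.m⊔n≤o⇒n≤o M N le)

  map-Eventually : {P Q : ℕ → Set} → (∀ i → P i → Q i) → Eventually P → Eventually Q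
  map-Eventually f (N , p) = N , λ i le → f i (p i le)

  witness : {P : ℕ → Set} → Eventually P → ∃[ i ] P i
  witness (N , p) = N , p N ℕₚ.≤-refl

  0<1 : 0ℚ < 1ℚ
  0<1 = positive⁻¹ 1ℚ

  natBound : ∀ x → ∃[ K ] Eventually (λ i → approx x i ≤ ι K)
  natBound x with isCauchy x 1ℚ 0<1
  ... | N , close with ι-natBound (∣ approx x N ∣ + 1ℚ) (+-mono-≤ (0≤∣p∣ (approx x N)) (<⇒≤ 0<1))
  ... | K , ≤K = K , N , λ i N≤i → ≤-trans (p≤∣p∣ (approx x i))
    (≤-trans (∣p∣≤∣q∣+r (approx x i) (approx x N) (close i N N≤i ℕₚ.≤-refl)) ≤K)

  ∣p∣≤p+1 : ∀ p → 0ℚ ≤ p + ½ → ∣ p ∣ ≤ p + 1ℚ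
  ∣p∣≤p+1 p 0≤ with ∣p∣≡p∨∣p∣≡-p p
  ... | inj₁ eq = begin
    ∣ p ∣       ≡⟨ eq ⟩
    p           ≡⟨ +-identityʳ p ⟨
    p + 0ℚ      ≤⟨ +-monoʳ-≤ p (<⇒≤ 0<1) ⟩
    p + 1ℚ      ∎
    where open ≤-Reasoning
  ... | inj₂ eq = begin
    ∣ p ∣                      ≡⟨ eq ⟩
    - p                        ≡⟨ +-identityʳ (- p) ⟨
    - p + (0ℚ + 0ℚ)            ≤⟨ +-monoʳ-≤ (- p) (+-mono-≤ 0≤ 0≤) ⟩
    - p + ((p + ½) + (p + ½))  ≡⟨ solve 1 (λ p → :- p :+ ((p :+ con ½) :+ (p :+ con ½)) := p :+ con 1ℚ) refl p ⟩
    p + 1ℚ                     ∎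
    where
    open ≤-Reasoning
    open +-*-Solver

  -- A bounded overshoot is harmless in a mean, so a natural number can replace a nonnegative real.
  -- The 4 consists of one unit for the ceiling, one added so that Y survives the drift from index N
  -- to i, one for the drift back, and one for passing from the absolute value to x itself.
  natApprox : ∀ x → 0ℝ Defs.≤ x → ∃[ Y ] Eventually (λ i → ∣ approx x i ∣ ≤ ι Y × ι Y ≤ approx x i + ι 4)
  natApprox x 0≤x with isCauchy x 1ℚ 0<1
  ... | N , close with natCeiling ∣ approx x N ∣ (0≤∣p∣ (approx x N))
  ... | k , ≤k , k≤ = suc k , map-Eventually bounds ((N , λ i N≤i → N≤i) ∧ 0≤x ½ (positive⁻¹ ½))
    where
    open ≤-Reasoning
    open +-*-Solver
    bounds : ∀ i → N ℕ.≤ i × 0ℚ ≤ approx x i + ½ →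
      ∣ approx x i ∣ ≤ ι (suc k) × ι (suc k) ≤ approx x i + ι 4
    bounds i (N≤i , 0≤xᵢ) = (begin
      ∣ approx x i ∣           ≤⟨ ∣p∣≤∣q∣+r (approx x i) (approx x N) (close i N N≤i ℕₚ.≤-refl) ⟩
      ∣ approx x N ∣ + 1ℚ      ≤⟨ +-monoˡ-≤ 1ℚ ≤k ⟩
      ι k + 1ℚ                 ≡⟨ ι-suc k ⟨
      ι (suc k)                ∎) , (begin
      ι (suc k)                ≡⟨ ι-suc k ⟩
      ι k + 1ℚ                 ≤⟨ +-monoˡ-≤ 1ℚ k≤ ⟩
      ∣ approx x N ∣ + 1ℚ + 1ℚ ≤⟨ +-monoˡ-≤ 1ℚ (+-monoˡ-≤ 1ℚ (∣p∣≤∣q∣+r (approx x N) (approx x i) (close N i ℕₚ.≤-refl N≤i))) ⟩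
      ∣ approx x i ∣ + 1ℚ + 1ℚ + 1ℚ ≤⟨ +-monoˡ-≤ 1ℚ (+-monoˡ-≤ 1ℚ (+-monoˡ-≤ 1ℚ (∣p∣≤p+1 (approx x i) 0≤xᵢ))) ⟩
      approx x i + 1ℚ + 1ℚ + 1ℚ + 1ℚ ≡⟨ solve 1 (λ p → p :+ con 1ℚ :+ con 1ℚ :+ con 1ℚ :+ con 1ℚ := p :+ con (+ 4 / 1)) refl (approx x i) ⟩
      approx x i + (+ 4 / 1)   ≡⟨ cong (λ e → approx x i + e) (ι≡/ 4) ⟨
      approx x i + ι 4         ∎)

  term≤sum : ∀ f {k n} → k ℕ.< n → f k ℕ.≤ sum f n
  term≤sum f {zero}  {suc n} _           = ℕₚ.m≤m+n (f 0) _
  term≤sum f {suc k} {suc n} (ℕ.s≤s k<n) = ℕₚ.≤-trans (term≤sum (λ j → f (suc j)) k<n) (ℕₚ.m≤n+m _ (f 0))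

  ∣fromℕ∣ : ∀ n → ∣ + n / 1 ∣ ≡ ι n
  ∣fromℕ∣ n = trans (cong ∣_∣ (sym (ι≡/ n))) (0≤p⇒∣p∣≡p (0≤ι n))

  private
    O-step : ∀ (c : ℚ) K f g → c ≤ ι K → ∣ + f / 1 ∣ ≤ c * ∣ + g / 1 ∣ + 1ℚ → f ℕ.≤ K ℕ.* g ℕ.+ 1
    O-step c K f g c≤K f≤cg = ι-cancel (begin
      ι f                       ≡⟨ ∣fromℕ∣ f ⟨
      ∣ + f / 1 ∣               ≤⟨ f≤cg ⟩
      c * ∣ + g / 1 ∣ + 1ℚ      ≡⟨ cong (λ z → c * z + 1ℚ) (∣fromℕ∣ g) ⟩
      c * ι g + 1ℚ              ≤⟨ +-monoˡ-≤ 1ℚ (*-monoʳ-≤-nonNeg (ι g) {{nonNegative (0≤ι g)}} c≤K) ⟩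
      ι K * ι g + 1ℚ            ≡⟨ cong (_+ 1ℚ) (ι-* K g) ⟨
      ι (K ℕ.* g) + 1ℚ          ≡⟨ ι-suc (K ℕ.* g) ⟨
      ι (suc (K ℕ.* g))         ≡⟨ cong ι (ℕₚ.+-comm 1 (K ℕ.* g)) ⟩
      ι (K ℕ.* g ℕ.+ 1)         ∎)
      where open ≤-Reasoning

    -- The real inequality is read with tolerance 1, at an index where the approximation of C is
    -- already below K. The tolerance is the `+ 1`.
    =O⇒eventually≤ : ∀ C K → Eventually (λ i → approx C i ≤ ι K) → (f g : ℕ → ℕ) →
      Eventually (λ n → Defs.∣ fromℕ (f n) ∣ Defs.≤ C Defs.* Defs.∣ fromℕ (g n) ∣) →
      Eventually (λ n → f n ℕ.≤ K ℕ.* g n ℕ.+ 1)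
    =O⇒eventually≤ C K C≤K f g (N , f≤Cg) = N , λ n N≤n →
      let i , c≤K , f≤cg = witness (C≤K ∧ f≤Cg n N≤n 1ℚ 0<1)
      in O-step (approx C i) K (f n) (g n) c≤K f≤cg

  -- Where g n ≥ 1, additive losses become multiplicative: one more copy of g n pays for the `+ 1`,
  -- and `sum f N` in the constant pays for all n < N.
  eventually≤⇒≤ : (f g : ℕ → ℕ) → ∀ K → Eventually (λ n → f n ℕ.≤ K ℕ.* g n ℕ.+ 1) →
    ∃[ K′ ] (∀ n → 1 ℕ.≤ g n → f n ℕ.≤ K′ ℕ.* g n)
  eventually≤⇒≤ f g K (N , large) = suc K ℕ.+ sum f N , bound
    where
    open ℕₚ.≤-Reasoning
    bound : ∀ n → 1 ℕ.≤ g n → f n ℕ.≤ (suc K ℕ.+ sum f N) ℕ.* g n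
    bound n 1≤g with ℕₚ.≤-<-connex N n
    ... | inj₁ N≤n = begin
      f n                             ≤⟨ large n N≤n ⟩
      K ℕ.* g n ℕ.+ 1                 ≤⟨ ℕₚ.+-monoʳ-≤ (K ℕ.* g n) 1≤g ⟩
      K ℕ.* g n ℕ.+ g n               ≡⟨ ℕₚ.+-comm (K ℕ.* g n) (g n) ⟩
      suc K ℕ.* g n                   ≤⟨ ℕₚ.*-monoˡ-≤ (g n) (ℕₚ.m≤m+n (suc K) (sum f N)) ⟩
      (suc K ℕ.+ sum f N) ℕ.* g n     ∎
    ... | inj₂ n<N = begin
      f n                             ≤⟨ term≤sum f n<N ⟩
      sum f N                         ≤⟨ ℕₚ.m≤n+m (sum f N) (suc K) ⟩
      suc K ℕ.+ sum f N               ≤⟨ ℕₚ.m≤m*n _ (g n) {{ℕ.>-nonZero 1≤g}} ⟩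
      (suc K ℕ.+ sum f N) ℕ.* g n     ∎

  =O⇒≤ : (f g : ℕ → ℕ) → (λ n → fromℕ (f n)) =O (λ n → fromℕ (g n)) →
    ∃[ K ] (∀ n → 1 ℕ.≤ g n → f n ℕ.≤ K ℕ.* g n)
  =O⇒≤ f g (C , f≤Cg) = let K , C≤K = natBound C in
    eventually≤⇒≤ f g K (=O⇒eventually≤ C K C≤K f g f≤Cg)

-- The truncation of 𝔖 and the resulting pointwise bound on r.

module SingularSeries where
  open import Data.Integer.Base using (+_; -[1+_])
  open import Data.Nat.Base as ℕ using (ℕ; zero; suc)
  import Data.Nat.Properties as ℕₚ
  open import Data.Nat.Solver renaming (module +-*-Solver to ℕ-Solver) using ()
  open import Data.Product.Base using (Σ-syntax; ∃-syntax; _×_; _,_; proj₁; proj₂)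
  open import Data.Rational.Base
  open import Data.Rational.Properties
  open import Data.Rational.Solver using (module +-*-Solver)
  open import Data.Sum.Base using (_⊎_; inj₁; inj₂)
  open import Relation.Binary.PropositionalEquality
  open import Relation.Nullary using (yes; no)
  open import Relation.Nullary.Negation using (contradiction)
  open import Defs using (ℝ; approx; isCauchy; fromℚ; fromℕ; 0ℝ; 1ℝ; IsPower; BoundedMoment; mean; _=O_; _=o_; ∑≤)
  open Rationals
  open Approximation
  open Sums ℕ-orderedSemiring using (sum; sum-∷ʳ)
  open OrderedSemiring ℚ-orderedSemiring using (_^_)

  ^-approx : ∀ x n i → approx (x Defs.^ n) i ≡ approx x i ^ n
  ^-approx x zero    i = refl
  ^-approx x (suc n) i = cong (approx x i *_) (^-approx x n i)

  ^-∣∣ : ∀ p n → ∣ p ^ n ∣ ≡ ∣ p ∣ ^ n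
  ^-∣∣ p zero    = refl
  ^-∣∣ p (suc n) = trans (∣p*q∣≡∣p∣*∣q∣ p (p ^ n)) (cong (∣ p ∣ *_) (^-∣∣ p n))

  ^-nonneg : ∀ {p} n → 0ℚ ≤ p → 0ℚ ≤ p ^ n
  ^-nonneg zero    0≤p = <⇒≤ 0<1
  ^-nonneg {p} (suc n) 0≤p = ≤-trans (≤-reflexive (sym (*-zeroʳ p))) (*-monoˡ 0≤p (^-nonneg n 0≤p))

  ^-mono : ∀ {p q} n → 0ℚ ≤ p → p ≤ q → p ^ n ≤ q ^ n
  ^-mono zero    0≤p p≤q = ≤-refl
  ^-mono {p} {q} (suc n) 0≤p p≤q = begin
    p * p ^ n   ≤⟨ *-monoˡ 0≤p (^-mono n 0≤p p≤q) ⟩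
    p * q ^ n   ≤⟨ *-monoʳ-≤-nonNeg (q ^ n) {{nonNegative (^-nonneg n (≤-trans 0≤p p≤q))}} p≤q ⟩
    q * q ^ n   ∎
    where open ≤-Reasoning

  ^-distribʳ : ∀ p q n → (p * q) ^ n ≡ p ^ n * q ^ n
  ^-distribʳ p q zero    = refl
  ^-distribʳ p q (suc n) = trans (cong (p * q *_) (^-distribʳ p q n))
    (solve 4 (λ p q a b → p :* q :* (a :* b) := p :* a :* (q :* b)) refl p q (p ^ n) (q ^ n))
    where open +-*-Solver

  ι-^ : ∀ m n → ι (m ℕ.^ n) ≡ ι m ^ n
  ι-^ m zero    = ι-1
  ι-^ m (suc n) = trans (ι-* m (m ℕ.^ n)) (cong (ι m *_) (ι-^ m n))

  ^-cancel : ∀ {p q} n → 0ℚ ≤ q → p ^ suc n ≤ q ^ suc n → p ≤ q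
  ^-cancel {p} {q} n 0≤q pⁿ≤qⁿ with p ≤? q
  ... | yes p≤q = p≤q
  ... | no p≰q = contradiction (<-≤-trans (^-mono-< n 0≤q (≰⇒> p≰q)) pⁿ≤qⁿ) (<-irrefl refl)
    where
    ^-mono-< : ∀ {p q} n → 0ℚ ≤ p → p < q → p ^ suc n < q ^ suc n
    ^-mono-< {p} {q} zero    0≤p p<q = subst₂ _<_ (sym (*-identityʳ p)) (sym (*-identityʳ q)) p<q
    ^-mono-< {p} {q} (suc n) 0≤p p<q = ≤-<-trans (*-monoˡ 0≤p (<⇒≤ (^-mono-< n 0≤p p<q)))
      (*-monoˡ-<-pos (q ^ suc n) {{positive (≤-<-trans (^-nonneg (suc n) 0≤p) (^-mono-< n 0≤p p<q))}} p<q)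

  -- Moves the tolerance 1 of a real inequality between powers into the base, so that a root can
  -- then be taken.
  p^n+1≤[p+1]^n : ∀ p n → 0ℚ ≤ p → p ^ suc n + 1ℚ ≤ (p + 1ℚ) ^ suc n
  p^n+1≤[p+1]^n p zero    0≤p = ≤-reflexive (trans (cong (_+ 1ℚ) (*-identityʳ p)) (sym (*-identityʳ (p + 1ℚ))))
  p^n+1≤[p+1]^n p (suc n) 0≤p = begin
    p * p ^ suc n + 1ℚ
      ≤⟨ +-monoʳ-≤ (p * p ^ suc n) (≤-trans (≤-reflexive (sym (+-identityˡ 1ℚ)))
           (+-monoˡ-≤ 1ℚ (+-mono-≤ 0≤p (^-nonneg (suc n) 0≤p)))) ⟩
    p * p ^ suc n + (p + p ^ suc n + 1ℚ)
      ≡⟨ solve 2 (λ p a → p :* a :+ (p :+ a :+ con 1ℚ) := (p :+ con 1ℚ) :* (a :+ con 1ℚ)) refl p (p ^ suc n) ⟩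
    (p + 1ℚ) * (p ^ suc n + 1ℚ)
      ≤⟨ *-monoˡ (+-mono-≤ 0≤p (<⇒≤ 0<1)) (p^n+1≤[p+1]^n p n 0≤p) ⟩
    (p + 1ℚ) * (p + 1ℚ) ^ suc n ∎
    where
    open ≤-Reasoning
    open +-*-Solver

  -- With k = d + 1: (L s)ᵏ ≤ s^(k+1) ≤ yᵏ + 1 ≤ (Y + 1)ᵏ.
  large-case : ∀ (s y : ℚ) L d Y → ι (L ℕ.^ suc d) ≤ s → ∣ y ∣ ≤ ι Y →
    s ^ suc (suc d) ≤ y ^ suc d + 1ℚ → ι L * s ≤ ι (suc Y)
  large-case s y L d Y Lᵏ≤s ∣y∣≤Y power = ^-cancel d (0≤ι (suc Y)) (begin
    (ι L * s) ^ suc d               ≡⟨ ^-distribʳ (ι L) s (suc d) ⟩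
    ι L ^ suc d * s ^ suc d         ≡⟨ cong (_* s ^ suc d) (ι-^ L (suc d)) ⟨
    ι (L ℕ.^ suc d) * s ^ suc d     ≤⟨ *-monoʳ-≤-nonNeg (s ^ suc d) {{nonNegative (^-nonneg (suc d) 0≤s)}} Lᵏ≤s ⟩
    s ^ suc (suc d)                 ≤⟨ power ⟩
    y ^ suc d + 1ℚ                  ≤⟨ +-monoˡ-≤ 1ℚ (p≤∣p∣ (y ^ suc d)) ⟩
    ∣ y ^ suc d ∣ + 1ℚ              ≡⟨ cong (_+ 1ℚ) (^-∣∣ y (suc d)) ⟩
    ∣ y ∣ ^ suc d + 1ℚ              ≤⟨ +-monoˡ-≤ 1ℚ (^-mono (suc d) (0≤∣p∣ y) ∣y∣≤Y) ⟩
    ι Y ^ suc d + 1ℚ                ≤⟨ p^n+1≤[p+1]^n (ι Y) d (0≤ι Y) ⟩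
    (ι Y + 1ℚ) ^ suc d              ≡⟨ cong (_^ suc d) (ι-suc Y) ⟨
    ι (suc Y) ^ suc d               ∎)
    where
    open ≤-Reasoning
    0≤s : 0ℚ ≤ s
    0≤s = ≤-trans (0≤ι (L ℕ.^ suc d)) Lᵏ≤s

  small-case : ∀ (s : ℚ) L m → s ≤ ι m → ι L * s ≤ ι (L ℕ.* m)
  small-case s L m s≤m = ≤-trans (*-monoˡ (0≤ι L) s≤m) (≤-reflexive (sym (ι-* L m)))

  -- The denominator of the positive rational that witnesses 0 < ε serves as k, since that rational
  -- is at least 1/k. At the rational exponent (k + 1)/k, `IsPower` yields an inequality between
  -- integer powers.
  1+1/k≤1+ε : ∀ ε → 0ℝ Defs.< ε → ∃[ d ] fromℚ (+ suc (suc d) / suc d) Defs.≤ 1ℝ Defs.+ ε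
  1+1/k≤1+ε ε (δ@(mkℚ -[1+ _ ] _ _) , *<* () , _)
  1+1/k≤1+ε ε (δ@(mkℚ (+ zero) d _) , 0<δ , _) = contradiction (positive 0<δ) λ ()
  1+1/k≤1+ε ε (δ@(mkℚ (+ suc n) d _) , 0<δ , N , ε≥) = d , λ η 0<η → N , λ i N≤i → begin
    + suc (suc d) / suc d      ≤⟨ *-cancelˡ-≤-pos (ι (suc d)) {{ι-pos d}} scaled ⟩
    1ℚ + (0ℚ + δ)              ≤⟨ +-monoʳ-≤ 1ℚ (ε≥ i N≤i) ⟩
    1ℚ + approx ε i            ≡⟨ +-identityʳ (1ℚ + approx ε i) ⟨
    1ℚ + approx ε i + 0ℚ       ≤⟨ +-monoʳ-≤ (1ℚ + approx ε i) (<⇒≤ 0<η) ⟩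
    1ℚ + approx ε i + η        ∎
    where
    open ≤-Reasoning
    open +-*-Solver
    scaled : ι (suc d) * (+ suc (suc d) / suc d) ≤ ι (suc d) * (1ℚ + (0ℚ + δ))
    scaled = begin
      ι (suc d) * (+ suc (suc d) / suc d)        ≡⟨ ι*/ (suc (suc d)) d ⟩
      ι (suc (suc d))                            ≡⟨ ι-suc (suc d) ⟩
      ι (suc d) + 1ℚ                             ≡⟨ cong (λ e → ι (suc d) + e) ι-1 ⟨
      ι (suc d) + ι 1                            ≤⟨ +-monoʳ-≤ (ι (suc d)) (ι-mono (ℕ.s≤s ℕ.z≤n)) ⟩
      ι (suc d) + ι (suc n)                      ≡⟨ cong (λ e → ι (suc d) + e) (ι*/ (suc n) d) ⟨
      ι (suc d) + ι (suc d) * (+ suc n / suc d)  ≡⟨ cong (λ e → ι (suc d) + ι (suc d) * e) (↥p/↧p≡p δ) ⟩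
      ι (suc d) + ι (suc d) * δ                  ≡⟨ solve 2 (λ a e → a :+ a :* e := a :* (con 1ℚ :+ (con 0ℚ :+ e))) refl (ι (suc d)) δ ⟩
      ι (suc d) * (1ℚ + (0ℚ + δ))                ∎

  ⅛ : ℚ
  ⅛ = + 1 / 8

  0<⅛ : 0ℚ < ⅛
  0<⅛ = positive⁻¹ ⅛

  -- As r is an integer, the two errors ⅛ are at most r / 4 in total.
  rep≤ : ∀ r (s j e : ℚ) → + r / 1 ≤ s * j + e + ⅛ → ∣ e ∣ ≤ ½ * ∣ + r / 1 ∣ + ⅛ →
    r ≡ 0 ⊎ ι r ≤ ι 4 * (s * j)
  rep≤ zero    s j e r≤ e≤ = inj₁ refl
  rep≤ (suc r) s j e r≤ e≤ = inj₂ (begin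
    ρ                    ≡⟨ solve 1 (λ r → r := con (+ 4 / 1) :* (con ¼ :* r)) refl ρ ⟩
    (+ 4 / 1) * (¼ * ρ)  ≤⟨ *-monoˡ {r = + 4 / 1} (nonNegative⁻¹ (+ 4 / 1)) (+-cancelʳ-≤ (¾ * ρ) {¼ * ρ} {s * j} quarter) ⟩
    (+ 4 / 1) * (s * j)  ≡⟨ cong (_* (s * j)) (ι≡/ 4) ⟨
    ι 4 * (s * j)        ∎)
    where
    open ≤-Reasoning
    open +-*-Solver
    ρ ¼ ¾ : ℚ
    ρ = ι (suc r)
    ¼ = + 1 / 4
    ¾ = + 3 / 4
    quarter : ¼ * ρ + ¾ * ρ ≤ s * j + ¾ * ρ
    quarter = begin
      ¼ * ρ + ¾ * ρ                ≡⟨ solve 1 (λ r → con ¼ :* r :+ con ¾ :* r := r) refl ρ ⟩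
      ρ                            ≡⟨ ι≡/ (suc r) ⟩
      + suc r / 1                  ≤⟨ r≤ ⟩
      s * j + e + ⅛                ≤⟨ +-monoˡ-≤ ⅛ (+-monoʳ-≤ (s * j) (≤-trans (p≤∣p∣ e) e≤)) ⟩
      s * j + (½ * ∣ + suc r / 1 ∣ + ⅛) + ⅛ ≡⟨ cong (λ z → s * j + (½ * z + ⅛) + ⅛) (∣fromℕ∣ (suc r)) ⟩
      s * j + (½ * ρ + ⅛) + ⅛      ≡⟨ solve 2 (λ a r → a :+ (con ½ :* r :+ con ⅛) :+ con ⅛ := a :+ (con ½ :* r :+ con ¼ :* con 1ℚ)) refl (s * j) ρ ⟩
      s * j + (½ * ρ + ¼ * 1ℚ)     ≤⟨ +-monoʳ-≤ (s * j) (+-monoʳ-≤ (½ * ρ) (*-monoˡ {r = ¼} (nonNegative⁻¹ ¼)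
                                        (≤-trans (≤-reflexive (sym ι-1)) (ι-mono (ℕ.s≤s ℕ.z≤n))))) ⟩
      s * j + (½ * ρ + ¼ * ρ)      ≡⟨ solve 2 (λ a r → a :+ (con ½ :* r :+ con ¼ :* r) := a :+ con ¾ :* r) refl (s * j) ρ ⟩
      s * j + ¾ * ρ                ∎

  -- The order of reals is not decidable, so the alternatives overlap. One approximation is compared
  -- with t + 1, and later ones differ from it by at most 1, which leaves t + 2 above and t below.
  small⊎large : ∀ s t → Eventually (λ i → approx s i ≤ ι (2 ℕ.+ t)) ⊎ Eventually (λ i → ι t ≤ approx s i)
  small⊎large s t = compare (isCauchy s 1ℚ 0<1)
    where
    open ≤-Reasoning
    compare : ∃[ N ] (∀ m n → N ℕ.≤ m → N ℕ.≤ n → ∣ approx s m - approx s n ∣ ≤ 1ℚ) →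
      Eventually (λ i → approx s i ≤ ι (2 ℕ.+ t)) ⊎ Eventually (λ i → ι t ≤ approx s i)
    compare (N , close) with approx s N ≤? ι (suc t)
    ... | yes small = inj₁ (N , λ i N≤i → begin
      approx s i         ≤⟨ p≤q+r (approx s i) (approx s N) (close i N N≤i ℕₚ.≤-refl) ⟩
      approx s N + 1ℚ    ≤⟨ +-monoˡ-≤ 1ℚ small ⟩
      ι (suc t) + 1ℚ     ≡⟨ ι-suc (suc t) ⟨
      ι (2 ℕ.+ t)        ∎)
    ... | no ¬small = inj₂ (N , λ i N≤i → +-cancelʳ-≤ 1ℚ (begin
      ι t + 1ℚ           ≡⟨ ι-suc t ⟨
      ι (suc t)          ≤⟨ <⇒≤ (≰⇒> ¬small) ⟩
      approx s N         ≤⟨ p≤q+r (approx s N) (approx s i) (close N i ℕₚ.≤-refl N≤i) ⟩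
      approx s i + 1ℚ    ∎))

  -- With k = d + 1 the cut-off is M = Lᵏ, for which M^(1/k) = L. Below it s is at most 2 + Lᵏ,
  -- which gives the product; the final 1 is the difference between Y + 1 and Y in the case of large
  -- s.
  threshold : ℕ → ℕ → ℕ
  threshold L d = L ℕ.* (2 ℕ.+ L ℕ.^ suc d) ℕ.+ 1

  -- The truncation s ≤ M + s^(1+ε) / M^ε, with M^ε ≥ L.
  truncation : ∀ s y L d Y .{{_ : ℕ.NonZero L}} →
    (1ℝ Defs.≤ s → s Defs.^ suc (suc d) Defs.≤ y Defs.^ suc d) →
    Eventually (λ i → ∣ approx y i ∣ ≤ ι Y) →
    Eventually (λ i → ι L * approx s i ≤ ι (threshold L d ℕ.+ Y))
  truncation s y L d Y power y≤Y with small⊎large s (L ℕ.^ suc d)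
  ... | inj₁ small = map-Eventually (λ i sᵢ≤ → ≤-trans (small-case (approx s i) L (2 ℕ.+ L ℕ.^ suc d) sᵢ≤)
          (ι-mono (ℕₚ.≤-trans (ℕₚ.m≤m+n _ 1) (ℕₚ.m≤m+n _ Y)))) small
  ... | inj₂ large = map-Eventually (λ i (≤sᵢ , ∣yᵢ∣≤ , powerᵢ) →
          ≤-trans (large-case (approx s i) (approx y i) L d Y ≤sᵢ ∣yᵢ∣≤
                    (subst₂ (λ a b → a ≤ b + 1ℚ) (^-approx s (suc (suc d)) i) (^-approx y (suc d) i) powerᵢ))
                  (ι-mono (ℕₚ.+-monoˡ-≤ Y (ℕₚ.m≤n+m 1 _))))
          (large ∧ y≤Y ∧ power 1≤s 1ℚ 0<1)
    where
    1≤s : 1ℝ Defs.≤ s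
    1≤s η 0<η = map-Eventually (λ i ≤sᵢ → begin
      1ℚ                   ≡⟨ ι-1 ⟨
      ι 1                  ≤⟨ ι-mono (ℕₚ.m^n>0 L (suc d)) ⟩
      ι (L ℕ.^ suc d)      ≤⟨ ≤sᵢ ⟩
      approx s i           ≡⟨ +-identityʳ (approx s i) ⟨
      approx s i + 0ℚ      ≤⟨ +-monoʳ-≤ (approx s i) (<⇒≤ 0<η) ⟩
      approx s i + η       ∎) large
      where open ≤-Reasoning

  private
    combine : ∀ L r (s j : ℚ) m → 0ℚ ≤ j → r ≡ 0 ⊎ ι r ≤ ι 4 * (s * j) → ι L * s ≤ ι m →
      ι (L ℕ.* r) ≤ ι 4 * j * ι m
    combine L r s j m 0≤j (inj₁ refl) Ls≤m = begin
      ι (L ℕ.* 0)         ≡⟨ cong ι (ℕₚ.*-zeroʳ L) ⟩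
      ι 0                 ≡⟨ ι-0 ⟩
      0ℚ                  ≡⟨ *-zeroʳ (ι 4 * j) ⟨
      ι 4 * j * 0ℚ        ≤⟨ *-monoˡ (≤-trans (≤-reflexive (sym (*-zeroʳ (ι 4)))) (*-monoˡ (0≤ι 4) 0≤j)) (0≤ι m) ⟩
      ι 4 * j * ι m       ∎
      where open ≤-Reasoning
    combine L r s j m 0≤j (inj₂ r≤) Ls≤m = begin
      ι (L ℕ.* r)             ≡⟨ ι-* L r ⟩
      ι L * ι r               ≤⟨ *-monoˡ (0≤ι L) r≤ ⟩
      ι L * (ι 4 * (s * j))   ≡⟨ solve 4 (λ l c s j → l :* (c :* (s :* j)) := c :* j :* (l :* s)) refl (ι L) (ι 4) s j ⟩
      ι 4 * j * (ι L * s)     ≤⟨ *-monoˡ (≤-trans (≤-reflexive (sym (*-zeroʳ (ι 4)))) (*-monoˡ (0≤ι 4) 0≤j)) Ls≤m ⟩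
      ι 4 * j * ι m           ∎
      where
      open ≤-Reasoning
      open +-*-Solver

  rep≤J*power : ∀ s y e r (j : ℚ) L d Y .{{_ : ℕ.NonZero L}} → 0ℚ ≤ j →
    (1ℝ Defs.≤ s → s Defs.^ suc (suc d) Defs.≤ y Defs.^ suc d) →
    Eventually (λ i → ∣ approx y i ∣ ≤ ι Y) →
    fromℕ r Defs.≤ s Defs.* fromℚ j Defs.+ e →
    Defs.∣ e ∣ Defs.≤ fromℚ ½ Defs.* Defs.∣ fromℕ r ∣ →
    ι (L ℕ.* r) ≤ ι 4 * j * ι (threshold L d ℕ.+ Y)
  rep≤J*power s y e r j L d Y 0≤j power y≤Y r≤ e≤ =
    let i , trunc , r≤ᵢ , e≤ᵢ = witness (truncation s y L d Y power y≤Y ∧ r≤ ⅛ 0<⅛ ∧ e≤ ⅛ 0<⅛)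
    in combine L r (approx s i) j (threshold L d ℕ.+ Y) 0≤j (rep≤ r (approx s i) j (approx e i) r≤ᵢ e≤ᵢ) trunc

  sum-natApprox : ∀ F (Y : ℕ → ℕ) → (∀ n → Eventually (λ i → ι (Y n) ≤ approx (F n) i + ι 4)) →
    ∀ x → Eventually (λ i → ι (sum Y (suc x)) ≤ approx (∑≤ x F) i + ι (4 ℕ.* suc x))
  sum-natApprox F Y Y≤ zero    = map-Eventually
    (λ i le → ≤-trans (≤-reflexive (cong ι (ℕₚ.+-identityʳ (Y 0)))) le) (Y≤ 0)
  sum-natApprox F Y Y≤ (suc x) = map-Eventually (λ i (le , leₓ) → begin
      ι (sum Y (suc (suc x)))                   ≡⟨ cong ι (sum-∷ʳ Y (suc x)) ⟩
      ι (sum Y (suc x) ℕ.+ Y (suc x))           ≡⟨ ι-+ (sum Y (suc x)) (Y (suc x)) ⟩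
      ι (sum Y (suc x)) + ι (Y (suc x))         ≤⟨ +-mono-≤ le leₓ ⟩
      (approx (∑≤ x F) i + ι (4 ℕ.* suc x)) + (approx (F (suc x)) i + ι 4)
        ≡⟨ solve 4 (λ a b c d → (a :+ b) :+ (c :+ d) := (a :+ c) :+ (b :+ d)) refl
             (approx (∑≤ x F) i) (ι (4 ℕ.* suc x)) (approx (F (suc x)) i) (ι 4) ⟩
      approx (∑≤ (suc x) F) i + (ι (4 ℕ.* suc x) + ι 4)
        ≡⟨ cong (λ z → approx (∑≤ (suc x) F) i + z) (trans (sym (ι-+ (4 ℕ.* suc x) 4)) (cong ι (4*suc x))) ⟩
      approx (∑≤ (suc x) F) i + ι (4 ℕ.* suc (suc x)) ∎)
    (sum-natApprox F Y Y≤ x ∧ Y≤ (suc x))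
    where
    open ≤-Reasoning
    open +-*-Solver
    4*suc : ∀ x → 4 ℕ.* suc x ℕ.+ 4 ≡ 4 ℕ.* suc (suc x)
    4*suc x = trans (ℕₚ.+-comm (4 ℕ.* suc x) 4) (sym (ℕₚ.*-suc 4 (suc x)))

  private
    mean-step : ∀ m K (c S : ℚ) Σ → c ≤ ι K → ∣ (+ 1 / suc m) * S ∣ ≤ c * ∣ 1ℚ ∣ + 1ℚ →
      ι Σ ≤ S + ι (4 ℕ.* suc (suc m)) → Σ ℕ.≤ (K ℕ.+ 9) ℕ.* suc m
    mean-step m K c S Σ c≤K mean≤ Σ≤ = ι-cancel (begin
      ι Σ                                                  ≤⟨ Σ≤ ⟩
      S + ι (4 ℕ.* suc (suc m))                            ≡⟨ cong (_+ ι (4 ℕ.* suc (suc m))) unscale ⟨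
      ι (suc m) * ((+ 1 / suc m) * S) + ι (4 ℕ.* suc (suc m))
        ≤⟨ +-monoˡ-≤ (ι (4 ℕ.* suc (suc m))) (*-monoˡ (0≤ι (suc m)) (≤-trans (p≤∣p∣ ((+ 1 / suc m) * S)) (≤-trans mean≤ c+1≤))) ⟩
      ι (suc m) * ι (suc K) + ι (4 ℕ.* suc (suc m))        ≡⟨ cong (_+ ι (4 ℕ.* suc (suc m))) (ι-* (suc m) (suc K)) ⟨
      ι (suc m ℕ.* suc K) + ι (4 ℕ.* suc (suc m))          ≡⟨ ι-+ (suc m ℕ.* suc K) (4 ℕ.* suc (suc m)) ⟨
      ι (suc m ℕ.* suc K ℕ.+ 4 ℕ.* suc (suc m))            ≤⟨ ι-mono absorb ⟩
      ι ((K ℕ.+ 9) ℕ.* suc m)                              ∎)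
      where
      open ≤-Reasoning
      unscale : ι (suc m) * ((+ 1 / suc m) * S) ≡ S
      unscale = trans (sym (*-assoc (ι (suc m)) (+ 1 / suc m) S))
        (trans (cong (_* S) (trans (ι*/ 1 m) ι-1)) (*-identityˡ S))
      c+1≤ : c * ∣ 1ℚ ∣ + 1ℚ ≤ ι (suc K)
      c+1≤ = ≤-trans (≤-reflexive (cong (_+ 1ℚ) (*-identityʳ c)))
        (≤-trans (+-monoˡ-≤ 1ℚ c≤K) (≤-reflexive (sym (ι-suc K))))
      -- K + 9 is K, plus 1 for the tolerance, plus 8 for the overshoot: the m + 2 terms exceed the
      -- true values by at most 4(m + 2) ≤ 8(m + 1).
      absorb : suc m ℕ.* suc K ℕ.+ 4 ℕ.* suc (suc m) ℕ.≤ (K ℕ.+ 9) ℕ.* suc m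
      absorb = ℕₚ.m+n≤o⇒m≤o _ (ℕₚ.≤-reflexive (ℕ-Solver.solve 2 (λ m k →
          (con 1 :+ m) :* (con 1 :+ k) :+ con 4 :* (con 2 :+ m) :+ con 4 :* m := (k :+ con 9) :* (con 1 :+ m)) refl m K))
        where open ℕ-Solver

    mean-bound : ∀ C F (Y : ℕ → ℕ) K → Eventually (λ i → approx C i ≤ ι K) →
      (∀ n → Eventually (λ i → ι (Y n) ≤ approx (F n) i + ι 4)) →
      Eventually (λ m → Defs.∣ mean F m ∣ Defs.≤ C Defs.* Defs.∣ 1ℝ ∣) →
      Eventually (λ x → sum Y (suc x) ℕ.≤ (K ℕ.+ 9) ℕ.* x ℕ.+ 1)
    mean-bound C F Y K C≤K Y≤ (N , mean≤) = suc N , bound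
      where
      -- `mean F m` is the average at x = m + 1, so m ≥ N means x ≥ N + 1.
      bound : ∀ x → suc N ℕ.≤ x → sum Y (suc x) ℕ.≤ (K ℕ.+ 9) ℕ.* x ℕ.+ 1
      bound (suc m) (ℕ.s≤s N≤m) =
        let i , c≤K , mean≤ᵢ , Y≤ᵢ = witness (C≤K ∧ mean≤ m N≤m 1ℚ 0<1 ∧ sum-natApprox F Y Y≤ (suc m))
        in ℕₚ.≤-trans (mean-step m K (approx C i) (approx (∑≤ (suc m) F) i) (sum Y (suc (suc m))) c≤K mean≤ᵢ Y≤ᵢ)
                      (ℕₚ.m≤m+n _ 1)

  mean=O1⇒sum≤ : ∀ F (Y : ℕ → ℕ) → (∀ n → Eventually (λ i → ι (Y n) ≤ approx (F n) i + ι 4)) →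
    mean F =O (λ _ → 1ℝ) → ∃[ K ] (∀ x → 1 ℕ.≤ x → sum Y (suc x) ℕ.≤ K ℕ.* x)
  mean=O1⇒sum≤ F Y Y≤ (C , mean≤) = let K , C≤K = natBound C in
    eventually≤⇒≤ (λ x → sum Y (suc x)) (λ x → x) (K ℕ.+ 9) (mean-bound C F Y K C≤K Y≤ mean≤)

  J-nonneg : ∀ 𝒜 h n → 0ℚ ≤ Defs.J 𝒜 h n
  J-nonneg 𝒜 = convPower-nonneg (λ k → 0≤/ (Defs.count 𝒜 k) k)
    where open Sums ℚ-orderedSemiring using (convPower-nonneg)

  -- Y n plays the role of 𝔖(n)^(1+ε).
  NatMajorant : (ℕ → ℕ) → (ℕ → ℚ) → Set
  NatMajorant r j = Σ[ Y ∈ (ℕ → ℕ) ]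
    (∃[ K ] (∀ x → 1 ℕ.≤ x → sum Y (suc x) ℕ.≤ K ℕ.* x)) ×
    (∀ L .{{_ : ℕ.NonZero L}} → ∃[ M ] Eventually (λ n → ι (L ℕ.* r n) ≤ ι 4 * j n * ι (M ℕ.+ Y n)))

  module _ (r : ℕ → ℕ) (j : ℕ → ℚ) (0≤j : ∀ n → 0ℚ ≤ j n) (𝔖 E : ℕ → ℝ)
           (r≤ : ∀ n → fromℕ (r n) Defs.≤ 𝔖 n Defs.* fromℚ (j n) Defs.+ E n)
           (E=o : E =o (λ n → fromℕ (r n))) (ε : ℝ) (0<ε : 0ℝ Defs.< ε) where
    private
      half : Eventually (λ n → Defs.∣ E n ∣ Defs.≤ fromℚ ½ Defs.* Defs.∣ fromℕ (r n) ∣)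
      half = E=o (fromℚ ½) (½ , positive⁻¹ ½ , 0 , λ _ _ → ≤-reflexive (+-identityˡ ½))

      majorant-from : ∀ (F : ℕ → ℝ) (Y : ℕ → ℕ) → (∀ n → IsPower (𝔖 n) (1ℝ Defs.+ ε) (F n)) →
        (∀ n → Eventually (λ i → ∣ approx (F n) i ∣ ≤ ι (Y n))) →
        ∀ d → fromℚ (+ suc (suc d) / suc d) Defs.≤ 1ℝ Defs.+ ε →
        ∀ L .{{_ : ℕ.NonZero L}} → ∃[ M ] Eventually (λ n → ι (L ℕ.* r n) ≤ ι 4 * j n * ι (M ℕ.+ Y n))
      -- The starting point is where |E| ≤ r/2 sets in and does not depend on L; only M does.
      majorant-from F Y isPower F≤Y d d≤ε L = threshold L d , proj₁ half , λ n N≤n →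
        rep≤J*power (𝔖 n) (F n) (E n) (r n) (j n) L d (Y n) (0≤j n)
          (λ 1≤s → IsPower.x≥1-lower (isPower n) (suc (suc d)) (suc d) 1≤s d≤ε)
          (F≤Y n) (r≤ n) (proj₂ half n N≤n)

    natMajorant : BoundedMoment 𝔖 (1ℝ Defs.+ ε) → NatMajorant r j
    natMajorant (F , isPower , mean≤) =
      let Y = λ n → natApprox (F n) (IsPower.nonNegative (isPower n))
          d , d≤ε = 1+1/k≤1+ε ε 0<ε
      in (λ n → proj₁ (Y n))
       , mean=O1⇒sum≤ F (λ n → proj₁ (Y n)) (λ n → map-Eventually (λ _ → proj₂) (proj₂ (Y n))) mean≤
       , majorant-from F (λ n → proj₁ (Y n)) isPower (λ n → map-Eventually (λ _ → proj₁) (proj₂ (Y n))) d d≤ε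

-- Positive density of the integers represented by ℬ.

module Density where
  open import Data.Nat.Base
  open import Data.Nat.Properties
  open import Data.Nat.DivMod using (_/_; _%_; m/n*n≤m; m≡m%n+[m/n]*n; m%n<n)
  open import Data.Nat.Solver using (module +-*-Solver)
  open import Data.Product.Base using (∃-syntax; _,_; proj₁; proj₂)
  open import Data.Sum.Base using (_⊎_; inj₁; inj₂)
  open import Relation.Binary.PropositionalEquality
  open import Relation.Nullary using (Dec; yes; no)
  open import Relation.Nullary.Decidable using (_⊎-dec_)
  open import Relation.Nullary.Negation using (contradiction)
  open import Relation.Unary using (Decidable)
  open Schnirelmann using (𝟙; members)
  open Counting using (^-distribʳ-*; n≤2^n; iterate-dilate; iterate-doubling)
  open Sums ℕ-orderedSemiring using (sum; sum-++; sum-+; sum-*ˡ; sum-mono; sum-monoʳ)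

  -- 0 and 1 are included so that the density bound below can start at n = 1.
  Support : (ℕ → ℕ) → ℕ → Set
  Support f n = n ≤ 1 ⊎ 0 < f n

  support? : ∀ f → Decidable (Support f)
  support? f n = (n ≤? 1) ⊎-dec (0 <? f n)

  𝟙≡1 : {P : Set} → P → (d : Dec P) → 𝟙 d ≡ 1
  𝟙≡1 p (yes _) = refl
  𝟙≡1 p (no ¬p) = contradiction p ¬p

  1≤members : ∀ f n → 1 ≤ n → 1 ≤ members (support? f) n
  1≤members f (suc n) _ = ≤-trans (≤-reflexive (sym (𝟙≡1 (inj₁ ≤-refl) (support? f 1)))) (m≤m+n _ _)

  members-mono : ∀ f {m n} → m ≤ n → members (support? f) m ≤ members (support? f) n
  members-mono f = sum-monoʳ {f = λ i → 𝟙 (support? f (suc i))} (λ _ → z≤n)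

  -- Put y = n / W. If y > N, then n ≤ W(y + 1) ≤ 2Wy and the bound at W y ≤ n applies. The
  -- remaining n are at most W(N + 2), and for them it is enough that 1 belongs to the support.
  dense-along-multiples : ∀ f W .{{_ : NonZero W}} k N →
    (∀ y → N ≤ y → 1 ≤ y → y ≤ k * members (support? f) (W * y)) →
    ∃[ k′ ] (∀ n → n ≤ k′ * members (support? f) n)
  dense-along-multiples f W k N along = 2 * W * k + W * (2 + N) , bound
    where
    open ≤-Reasoning
    bound : ∀ n → n ≤ (2 * W * k + W * (2 + N)) * members (support? f) n
    bound zero = z≤n
    bound n@(suc _) with ≤-<-connex (suc N) (n / W)
    ... | inj₁ N<y = begin
      n                             ≤⟨ n≤ ⟩
      W * suc y                     ≤⟨ *-monoʳ-≤ W (+-monoˡ-≤ y 1≤y) ⟩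
      W * (y + y)                   ≡⟨ solve 2 (λ w y → w :* (y :+ y) := con 2 :* w :* y) refl W y ⟩
      2 * W * y                     ≤⟨ *-monoʳ-≤ (2 * W) (along y (≤-trans (n≤1+n N) N<y) 1≤y) ⟩
      2 * W * (k * members (support? f) (W * y))
                                    ≤⟨ *-monoʳ-≤ (2 * W) (*-monoʳ-≤ k (members-mono f Wy≤n)) ⟩
      2 * W * (k * v)               ≡⟨ *-assoc (2 * W) k v ⟨
      2 * W * k * v                 ≤⟨ *-monoˡ-≤ v (m≤m+n (2 * W * k) _) ⟩
      (2 * W * k + W * (2 + N)) * v ∎
      where
      open +-*-Solver
      y v : ℕ
      y = n / W
      v = members (support? f) n
      1≤y : 1 ≤ y
      1≤y = ≤-trans (s≤s z≤n) N<y
      Wy≤n : W * y ≤ n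
      Wy≤n = ≤-trans (≤-reflexive (*-comm W y)) (m/n*n≤m n W)
      n≤ : n ≤ W * suc y
      n≤ = ≤-trans (≤-reflexive (m≡m%n+[m/n]*n n W)) (≤-trans (+-monoˡ-≤ (y * W) (<⇒≤ (m%n<n n W)))
        (≤-reflexive (*-comm (suc y) W)))
    ... | inj₂ y≤N = begin
      n                             ≡⟨ m≡m%n+[m/n]*n n W ⟩
      n % W + n / W * W             ≤⟨ +-mono-≤ (<⇒≤ (m%n<n n W)) (*-monoˡ-≤ W (<⇒≤ y≤N)) ⟩
      W + suc N * W                 ≡⟨ *-comm (2 + N) W ⟩
      W * (2 + N)                   ≤⟨ m≤n+m _ (2 * W * k) ⟩
      2 * W * k + W * (2 + N)       ≤⟨ m≤m*n _ (members (support? f) n) {{>-nonZero (1≤members f n (s≤s z≤n))}} ⟩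
      (2 * W * k + W * (2 + N)) * members (support? f) n ∎

  -- `a` and `b` stand for the counting functions of 𝒜 and ℬ, `rᵃ` and `rᵇ` for their representation
  -- counts, `Y` for the natural majorant of 𝔖^(1+ε). Only inequalities between natural numbers
  -- remain; `L` on the left of `rᵃ-≤` is the gain of the truncation, `M` its cost.
  module _ (h : ℕ) (1≤h : 1 ≤ h) (a b rᵃ rᵇ Y : ℕ → ℕ)
           (1≤a : ∀ x → 1 ≤ a x) (a-mono : ∀ {x y} → x ≤ y → a x ≤ a y)
           (K : ℕ) (a≤Kb : ∀ x → a x ≤ suc K * b x)
           (K₂ : ℕ) (doubling : ∀ x → a (2 * x) ≤ K₂ * a x)
           (Q : ℕ) .{{_ : NonZero Q}} (dilate : ∀ x → 1 ≤ x → 2 * a x ≤ a (Q * x))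
           (rᵇ≤rᵃ : ∀ n → rᵇ n ≤ rᵃ n)
           (sum-rᵇ-≤ : ∀ x → sum rᵇ (suc x) ≤ a x ^ h)
           (sum-rᵇ-≥ : ∀ x → b x ^ h ≤ sum rᵇ (suc (h * x)))
           (Cʸ : ℕ) (sum-Y-≤ : ∀ x → 1 ≤ x → sum Y (suc x) ≤ Cʸ * x)
           (C : ℕ) (rᵃ-≤ : ∀ L .{{_ : NonZero L}} →
             ∃[ M ] ∃[ N ] (∀ n → N ≤ n → L * rᵃ n * suc n ≤ C * a n ^ h * (M + Y n))) where
    private
      instance
        h≢0 : NonZero h
        h≢0 = >-nonZero 1≤h

      -- Dilation by P = Qʲ multiplies A by 2ʲ ≥ 2(K + 1), which makes up for the factor K + 1
      -- between A and B and leaves a factor 2. Sums of h elements of [0, Py] lie in [0, Wy]. In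
      -- `c₁` the power comes from comparing A(Wy) with B(Py), and the 2 from discarding the
      -- representations of n ≤ y.
      j P W c₁ c₂ L : ℕ
      j  = 2 * suc K
      P  = Q ^ j
      W  = h * P
      c₁ = (K₂ ^ h * suc K) ^ h * 2
      c₂ = C * c₁
      L  = suc (c₂ * (Cʸ * W))

      instance
        P≢0 : NonZero P
        P≢0 = m^n≢0 Q j
        W≢0 : NonZero W
        W≢0 = m*n≢0 h P

      y≤Wy : ∀ y → y ≤ W * y
      y≤Wy y = m≤n*m y W

      -- The range of summation is (y, W y].
      gap : ℕ → ℕ
      gap y = sum (λ i → rᵇ (suc y + i)) (W * y ∸ y)

      sum-split : ∀ f y → sum f (suc (W * y)) ≡ sum f (suc y) + sum (λ i → f (suc y + i)) (W * y ∸ y)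
      sum-split f y = trans (cong (λ n → sum f (suc n)) (sym (m+[n∸m]≡n (y≤Wy y)))) (sum-++ f (suc y) (W * y ∸ y))

      2a≤b : ∀ y → 1 ≤ y → 2 * a y ≤ b (P * y)
      2a≤b y 1≤y = *-cancelˡ-≤ (suc K) (begin
        suc K * (2 * a y)       ≡⟨ solve 2 (λ k a → k :* (con 2 :* a) := con 2 :* k :* a) refl (suc K) (a y) ⟩
        j * a y                 ≤⟨ *-monoˡ-≤ (a y) (n≤2^n j) ⟩
        2 ^ j * a y             ≤⟨ iterate-dilate a Q dilate j y 1≤y ⟩
        a (P * y)               ≤⟨ a≤Kb (P * y) ⟩
        suc K * b (P * y)       ∎)
        where
        open ≤-Reasoning
        open +-*-Solver

      -- Since 2 a(y) ≤ b(P y), at most half of the representations are of integers n ≤ y.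
      b^h≤gap : ∀ y → 1 ≤ y → b (P * y) ^ h ≤ 2 * gap y
      b^h≤gap y 1≤y = +-cancelˡ-≤ B _ _ (begin
        B + B                           ≡⟨ cong (B +_) (+-identityʳ B) ⟨
        2 * B                           ≤⟨ *-monoʳ-≤ 2 (sum-rᵇ-≥ (P * y)) ⟩
        2 * sum rᵇ (suc (h * (P * y)))  ≡⟨ cong (λ x → 2 * sum rᵇ (suc x)) (*-assoc h P y) ⟨
        2 * sum rᵇ (suc (W * y))        ≡⟨ cong (2 *_) (sum-split rᵇ y) ⟩
        2 * (sum rᵇ (suc y) + gap y)    ≤⟨ *-monoʳ-≤ 2 (+-monoˡ-≤ (gap y) (sum-rᵇ-≤ y)) ⟩
        2 * (a y ^ h + gap y)           ≡⟨ *-distribˡ-+ 2 (a y ^ h) (gap y) ⟩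
        2 * a y ^ h + 2 * gap y         ≤⟨ +-monoˡ-≤ (2 * gap y) (*-monoˡ-≤ (a y ^ h) (^-monoʳ-≤ 2 1≤h)) ⟩
        2 ^ h * a y ^ h + 2 * gap y     ≡⟨ cong (_+ 2 * gap y) (^-distribʳ-* h 2 (a y)) ⟨
        (2 * a y) ^ h + 2 * gap y       ≤⟨ +-monoˡ-≤ (2 * gap y) (^-monoˡ-≤ h (2a≤b y 1≤y)) ⟩
        B + 2 * gap y                   ∎)
        where
        open ≤-Reasoning
        B : ℕ
        B = b (P * y) ^ h

      -- As W = h P and h ≤ 2ʰ, at most h doublings lead from P y to W y.
      a^h≤gap : ∀ y → 1 ≤ y → a (W * y) ^ h ≤ c₁ * gap y
      a^h≤gap y 1≤y = begin
        a (W * y) ^ h                            ≤⟨ ^-monoˡ-≤ h a≤b ⟩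
        (K₂ ^ h * suc K * b (P * y)) ^ h         ≡⟨ ^-distribʳ-* h (K₂ ^ h * suc K) (b (P * y)) ⟩
        (K₂ ^ h * suc K) ^ h * b (P * y) ^ h     ≤⟨ *-monoʳ-≤ ((K₂ ^ h * suc K) ^ h) (b^h≤gap y 1≤y) ⟩
        (K₂ ^ h * suc K) ^ h * (2 * gap y)       ≡⟨ *-assoc ((K₂ ^ h * suc K) ^ h) 2 (gap y) ⟨
        c₁ * gap y                               ∎
        where
        open ≤-Reasoning
        a≤b : a (W * y) ≤ K₂ ^ h * suc K * b (P * y)
        a≤b = begin
          a (W * y)                         ≡⟨ cong a (*-assoc h P y) ⟩
          a (h * (P * y))                   ≤⟨ a-mono (*-monoˡ-≤ (P * y) (n≤2^n h)) ⟩
          a (2 ^ h * (P * y))               ≤⟨ iterate-doubling a K₂ doubling h (P * y) ⟩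
          K₂ ^ h * a (P * y)                ≤⟨ *-monoʳ-≤ (K₂ ^ h) (a≤Kb (P * y)) ⟩
          K₂ ^ h * (suc K * b (P * y))      ≡⟨ *-assoc (K₂ ^ h) (suc K) (b (P * y)) ⟨
          K₂ ^ h * suc K * b (P * y)        ∎

      M N : ℕ
      M = proj₁ (rᵃ-≤ L)
      N = proj₁ (proj₂ (rᵃ-≤ L))

      δ : ℕ → ℕ
      δ n = 𝟙 (support? rᵇ n)

      -- Outside the support the left side is 0, so M is charged only at members; this is how their
      -- number appears after summation. The lower end y ≤ n lets y replace n + 1 on the left.
      rᵇ-pointwise : ∀ y n → N ≤ n → y ≤ n → n ≤ W * y →
        L * y * rᵇ n ≤ C * a (W * y) ^ h * (M * δ n + Y n)
      rᵇ-pointwise y n N≤n y≤n n≤Wy with support? rᵇ n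
      ... | yes _ = begin
        L * y * rᵇ n                          ≤⟨ *-mono-≤ (*-monoʳ-≤ L (≤-trans y≤n (n≤1+n n))) (rᵇ≤rᵃ n) ⟩
        L * suc n * rᵃ n                      ≡⟨ solve 3 (λ l n r → l :* n :* r := l :* r :* n) refl L (suc n) (rᵃ n) ⟩
        L * rᵃ n * suc n                      ≤⟨ proj₂ (proj₂ (rᵃ-≤ L)) n N≤n ⟩
        C * a n ^ h * (M + Y n)               ≤⟨ *-mono-≤ (*-monoʳ-≤ C (^-monoˡ-≤ h (a-mono n≤Wy)))
                                                   (+-monoˡ-≤ (Y n) (≤-reflexive (sym (*-identityʳ M)))) ⟩
        C * a (W * y) ^ h * (M * 1 + Y n)     ∎
        where
        open ≤-Reasoning
        open +-*-Solver
      ... | no ∉ = ≤-trans (≤-reflexive (trans (cong (L * y *_) (n≤0⇒n≡0 (≮⇒≥ (λ pos → ∉ (inj₂ pos))))) (*-zeroʳ (L * y)))) z≤n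

      summed : ∀ y → N ≤ y → 1 ≤ y →
        L * y * gap y ≤ C * a (W * y) ^ h * (M * members (support? rᵇ) (W * y) + Cʸ * (W * y))
      summed y N≤y 1≤y = begin
        L * y * gap y
          ≡⟨ sum-*ˡ (L * y) (λ i → rᵇ (suc y + i)) d ⟨
        sum (λ i → L * y * rᵇ (suc y + i)) d
          ≤⟨ sum-mono d (λ i i<d → rᵇ-pointwise y (suc y + i) (≤-trans N≤y (y≤ i)) (y≤ i)
               (≤-trans (≤-reflexive (sym (+-suc y i))) (≤-trans (+-monoʳ-≤ y i<d) (≤-reflexive (m+[n∸m]≡n (y≤Wy y)))))) ⟩
        sum (λ i → B * (M * δ (suc y + i) + Y (suc y + i))) d
          ≡⟨ sum-*ˡ B (λ i → M * δ (suc y + i) + Y (suc y + i)) d ⟩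
        B * sum (λ i → M * δ (suc y + i) + Y (suc y + i)) d
          ≡⟨ cong (B *_) (sum-+ (λ i → M * δ (suc y + i)) (λ i → Y (suc y + i)) d) ⟩
        B * (sum (λ i → M * δ (suc y + i)) d + sum (λ i → Y (suc y + i)) d)
          ≡⟨ cong (λ s → B * (s + sum (λ i → Y (suc y + i)) d)) (sum-*ˡ M (λ i → δ (suc y + i)) d) ⟩
        B * (M * sum (λ i → δ (suc y + i)) d + sum (λ i → Y (suc y + i)) d)
          ≤⟨ *-monoʳ-≤ B (+-mono-≤ (*-monoʳ-≤ M δ≤) Y≤) ⟩
        B * (M * members (support? rᵇ) (W * y) + Cʸ * (W * y)) ∎
        where
        open ≤-Reasoning
        d B : ℕ
        d = W * y ∸ y
        B = C * a (W * y) ^ h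
        y≤ : ∀ i → y ≤ suc y + i
        y≤ i = ≤-trans (m≤m+n y i) (n≤1+n (y + i))
        δ≤ : sum (λ i → δ (suc y + i)) d ≤ members (support? rᵇ) (W * y)
        δ≤ = ≤-trans (m≤n+m _ (members (support? rᵇ) y)) (≤-reflexive (trans
          (sym (sum-++ (λ i → δ (suc i)) y d)) (cong (members (support? rᵇ)) (m+[n∸m]≡n (y≤Wy y)))))
        Y≤ : sum (λ i → Y (suc y + i)) d ≤ Cʸ * (W * y)
        Y≤ = ≤-trans (m≤n+m _ (sum Y (suc y))) (≤-trans (≤-reflexive (sym (sum-split Y y)))
          (sum-Y-≤ (W * y) (≤-trans 1≤y (y≤Wy y))))

      -- Needed to divide by `gap y`. It follows from A(Wy) ≥ 1, since a vanishing gap would force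
      -- A(Wy)ʰ = 0.
      gap>0 : ∀ y → 1 ≤ y → 0 < gap y
      gap>0 y 1≤y = n≢0⇒n>0 λ gap≡0 → <⇒≱ (≤-trans (m^n>0 (a (W * y)) {{>-nonZero (1≤a (W * y))}} h) (a^h≤gap y 1≤y))
        (≤-reflexive (trans (cong (c₁ *_) gap≡0) (*-zeroʳ c₁)))

      -- L exceeds c₂ Cʸ W, so that the moment term is absorbed by the left-hand side.
      along : ∀ y → N ≤ y → 1 ≤ y → y ≤ c₂ * M * members (support? rᵇ) (W * y)
      along y N≤y 1≤y = +-cancelʳ-≤ (c₂ * (Cʸ * W) * y) _ _ (*-cancelʳ-≤ _ _ (gap y) {{>-nonZero (gap>0 y 1≤y)}} (begin
        L * y * gap y
          ≤⟨ summed y N≤y 1≤y ⟩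
        C * a (W * y) ^ h * (M * v + Cʸ * (W * y))
          ≤⟨ *-monoˡ-≤ _ (*-monoʳ-≤ C (a^h≤gap y 1≤y)) ⟩
        C * (c₁ * gap y) * (M * v + Cʸ * (W * y))
          ≡⟨ solve 8 (λ c c₁ g m v c′ w y → c :* (c₁ :* g) :* (m :* v :+ c′ :* (w :* y)) :=
               (c :* c₁ :* m :* v :+ c :* c₁ :* (c′ :* w) :* y) :* g) refl C c₁ (gap y) M v Cʸ W y ⟩
        (c₂ * M * v + c₂ * (Cʸ * W) * y) * gap y ∎))
        where
        open ≤-Reasoning
        open +-*-Solver
        v : ℕ
        v = members (support? rᵇ) (W * y)

    support-dense : ∃[ k ] (∀ n → n ≤ k * members (support? rᵇ) n)
    support-dense = dense-along-multiples rᵇ W (c₂ * M) N along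

-- From positive density to additive bases, for 𝒜 and its subsequences.

module Basis where
  open import Data.Nat.Base
  open import Data.Nat.Properties
  open import Data.Product.Base using (∃-syntax; _×_; _,_; proj₁; proj₂)
  open import Data.Rational.Base as ℚ using ()
  import Data.Rational.Properties as ℚₚ
  open import Data.Nat.Solver renaming (module +-*-Solver to ℕ-Solver) using ()
  open import Data.Rational.Solver renaming (module +-*-Solver to ℚ-Solver) using ()
  open import Data.Sum.Base using (inj₁; inj₂)
  open import Data.Vec.Base using ([])
  open import Data.Vec.Relation.Unary.All using ([])
  open import Relation.Binary.PropositionalEquality hiding (J)
  open import Relation.Unary using (Decidable)
  open import Defs using (Sequence; term; k≤term; _∈_; _⊆_; count; rep; J; IsAdditiveBasis; IsStableBasis)
  open Rationals
  open Counting
  open Density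
  open Approximation using (=O⇒≤)
  open SingularSeries using (NatMajorant)
  open Schnirelmann using (_⊕_; members; sumset; schnirelmann)
  open Sums ℕ-orderedSemiring using (sum; sum-mono)

  -- The integers 0 and 1, placed in the support by definition, are genuine sums of h elements
  -- because 0, 1 ∈ ℬ: the sums are padded with zeros, and 1 takes up one of the h ≥ 1 places.
  support⇒Representable : ∀ ℬ h → 1 ≤ h → 0 ∈ ℬ → 1 ∈ ℬ → ∀ n → Support (rep ℬ h) n → Representable ℬ h n
  support⇒Representable ℬ h 1≤h 0∈ 1∈ zero (inj₁ _) = 0-Representable {ℬ} 0∈ h
  support⇒Representable ℬ (suc h) 1≤h 0∈ 1∈ (suc zero) (inj₁ _) =
    Representable-∷ {ℬ} 1∈ (0-Representable {ℬ} 0∈ h)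
  support⇒Representable ℬ h 1≤h 0∈ 1∈ (suc (suc n)) (inj₁ (s≤s ()))
  support⇒Representable ℬ h 1≤h 0∈ 1∈ n (inj₂ pos) = rep>0⇒Representable ℬ h n pos

  sumset⇒Representable : ∀ ℬ h {D : ℕ → Set} (D? : Decidable D) (D0 : D 0) →
    (∀ n → D n → Representable ℬ h n) → ∀ j n → sumset D? D0 j n → Representable ℬ (j * h) n
  sumset⇒Representable ℬ h D? D0 D⇒ zero    n refl = [] , [] , refl
  sumset⇒Representable ℬ h D? D0 D⇒ (suc j) n (m , s≤s m≤n , m∈ , n-m∈) =
    subst (Representable ℬ (h + j * h)) (m∸n+n≡m m≤n)
      (Representable-+ {ℬ} (D⇒ (n ∸ m) n-m∈) (sumset⇒Representable ℬ h D? D0 D⇒ j m m∈))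

  ⊕⇒Representable : ∀ ℬ g {S : ℕ → Set} → (∀ n → S n → Representable ℬ g n) →
    ∀ n → (S ⊕ S) n → Representable ℬ (g + g) n
  ⊕⇒Representable ℬ g S⇒ n (m , s≤s m≤n , m∈ , n-m∈) = subst (Representable ℬ (g + g)) (m+[n∸m]≡n m≤n)
    (Representable-+ {ℬ} (S⇒ m m∈) (S⇒ (n ∸ m) n-m∈))

  dense⇒basis : ∀ ℬ h → 1 ≤ h → {D : ℕ → Set} (D? : Decidable D) → D 0 →
    (∀ n → D n → Representable ℬ h n) → ∃[ k ] (∀ n → n ≤ k * members D? n) → IsAdditiveBasis ℬ
  dense⇒basis ℬ h 1≤h D? D0 D⇒ (k , dense) =
    let j , 1≤j , covers = schnirelmann D? D0 k dense
        1≤jh = *-mono-≤ 1≤j 1≤h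
    -- The order is 2jh: j sums of h elements cover at least half of every [1, n], and two such sums
    -- reach n. It is at least 2 because j, h ≥ 1.
    in j * h + j * h , +-mono-≤ 1≤jh 1≤jh ,
       λ n → ⊕⇒Representable ℬ (j * h) (sumset⇒Representable ℬ h D? D0 D⇒ j) n (covers n)

  module _ (𝒜 : Sequence) (0∈𝒜 : 0 ∈ 𝒜) (1∈𝒜 : 1 ∈ 𝒜) where
    -- The bound given for nonzero terms extends to n = 0 because a_0 = 0. Adding 2 to the constant
    -- ensures that Q = K² is at least 2, as the recursion on n / Q demands.
    term-doubling : ∃[ K ] (∀ n → 1 ≤ term 𝒜 n → term 𝒜 (2 * n) ≤ K * term 𝒜 n) →
      ∃[ K ] (2 ≤ K × (∀ n → term 𝒜 (2 * n) ≤ K * term 𝒜 n))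
    term-doubling (K , bound) = 2 + K , s≤s (s≤s z≤n) , bound′
      where
      open ≤-Reasoning
      term₀ : term 𝒜 0 ≡ 0
      term₀ = n≤0⇒n≡0 (≤-trans (term-mono-≤ 𝒜 z≤n) (≤-reflexive (proj₂ 0∈𝒜)))
      bound′ : ∀ n → term 𝒜 (2 * n) ≤ (2 + K) * term 𝒜 n
      bound′ zero      = ≤-trans (≤-reflexive term₀) z≤n
      bound′ n@(suc _) = ≤-trans (bound n (≤-trans (s≤s z≤n) (k≤term 𝒜 n))) (*-monoˡ-≤ (term 𝒜 n) (m≤n+m K 2))

    module _ (h : ℕ) (1≤h : 1 ≤ h)
             (K₁ : ℕ) (count-doubling : ∀ x → count 𝒜 (2 * x) ≤ K₁ * count 𝒜 x)
             (K₂ : ℕ) (2≤K₂ : 2 ≤ K₂) (doubling : ∀ n → term 𝒜 (2 * n) ≤ K₂ * term 𝒜 n)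
             (Y : ℕ → ℕ) (Cʸ : ℕ) (sum-Y-≤ : ∀ x → 1 ≤ x → sum Y (suc x) ≤ Cʸ * x)
             (rep-≤ : ∀ L .{{_ : NonZero L}} →
               ∃[ M ] ∃[ N ] (∀ n → N ≤ n → ι (L * rep 𝒜 h n) ℚ.≤ ι 4 ℚ.* J 𝒜 h n ℚ.* ι (M + Y n))) where
      private
        Q : ℕ
        Q = K₂ * K₂
        2≤Q : 2 ≤ Q
        2≤Q = ≤-trans 2≤K₂ (m≤m*n K₂ K₂ {{>-nonZero (≤-trans (s≤s z≤n) 2≤K₂)}})
        dilate : ∀ x → 1 ≤ x → 2 * count 𝒜 x ≤ count 𝒜 (Q * x)
        dilate = count-dilate 𝒜 0∈𝒜 1∈𝒜 K₂ doubling
        open SingularIntegral.Bound (count 𝒜) (count-mono 𝒜) Q 2≤Q dilate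

        rearrange : ∀ m j c → 4 * m * (j * c) ≡ 4 * j * c * m
        rearrange = solve 3 (λ m j c → con 4 :* m :* (j :* c) := con 4 :* j :* c :* m) refl
          where open ℕ-Solver

        rep*n-≤ : ∀ L .{{_ : NonZero L}} →
          ∃[ M ] ∃[ N ] (∀ n → N ≤ n → L * rep 𝒜 h n * suc n ≤ 4 * J-const h * count 𝒜 n ^ h * (M + Y n))
        rep*n-≤ L = proj₁ (rep-≤ L) , proj₁ (proj₂ (rep-≤ L)) , λ n N≤n →
          scale (rep 𝒜 h n) n _ (proj₂ (proj₂ (rep-≤ L)) n N≤n)
          where
          open ℚₚ.≤-Reasoning
          open ℚ-Solver
          scale : ∀ r n m → ι (L * r) ℚ.≤ ι 4 ℚ.* J 𝒜 h n ℚ.* ι m →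
            L * r * suc n ≤ 4 * J-const h * count 𝒜 n ^ h * m
          scale r n m r≤ = ι-cancel (begin
            ι (L * r * suc n)
              ≡⟨ ι-* (L * r) (suc n) ⟩
            ι (L * r) ℚ.* ι (suc n)
              ≤⟨ ℚₚ.*-monoʳ-≤-nonNeg (ι (suc n)) {{ℚ.nonNegative (0≤ι (suc n))}} r≤ ⟩
            ι 4 ℚ.* J 𝒜 h n ℚ.* ι m ℚ.* ι (suc n)
              ≡⟨ solve 4 (λ c j m n → c :* j :* m :* n := c :* m :* (n :* j)) refl (ι 4) (J 𝒜 h n) (ι m) (ι (suc n)) ⟩
            ι 4 ℚ.* ι m ℚ.* (ι (suc n) ℚ.* J 𝒜 h n)
              -- `J 𝒜 h n` and `convPower w h n` agree by definition, so the bound on convolution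
              -- powers applies as it stands.
              ≤⟨ *-monoˡ (ℚₚ.≤-trans (0≤ι (4 * m)) (ℚₚ.≤-reflexive (ι-* 4 m))) (convPower-w-≤ h n) ⟩
            ι 4 ℚ.* ι m ℚ.* ι (J-const h * count 𝒜 n ^ h)
              ≡⟨ cong (ℚ._* ι (J-const h * count 𝒜 n ^ h)) (ι-* 4 m) ⟨
            ι (4 * m) ℚ.* ι (J-const h * count 𝒜 n ^ h)
              ≡⟨ ι-* (4 * m) (J-const h * count 𝒜 n ^ h) ⟨
            ι (4 * m * (J-const h * count 𝒜 n ^ h))
              ≡⟨ cong ι (rearrange m (J-const h) (count 𝒜 n ^ h)) ⟩
            ι (4 * J-const h * count 𝒜 n ^ h * m) ∎)

      subsequence-basis : ∀ ℬ → ℬ ⊆ 𝒜 → 0 ∈ ℬ → 1 ∈ ℬ →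
        ∀ K → (∀ x → count 𝒜 x ≤ suc K * count ℬ x) → IsAdditiveBasis ℬ
      subsequence-basis ℬ ℬ⊆𝒜 0∈ 1∈ K 𝒜≤Kℬ = dense⇒basis ℬ h 1≤h (support? (rep ℬ h)) (inj₁ z≤n)
        (support⇒Representable ℬ h 1≤h 0∈ 1∈)
        (support-dense h 1≤h (count 𝒜) (count ℬ) (rep 𝒜 h) (rep ℬ h) Y
          (1≤count {𝒜} 0∈𝒜) (count-mono 𝒜) K 𝒜≤Kℬ K₁ count-doubling Q dilate rep≤ sum-rep≤ (sum-rep-≥ ℬ h)
          Cʸ sum-Y-≤ (4 * J-const h) rep*n-≤)
        where
        rep≤ : ∀ n → rep ℬ h n ≤ rep 𝒜 h n
        rep≤ = rep-mono ℬ 𝒜 ℬ⊆𝒜 h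
        sum-rep≤ : ∀ x → sum (rep ℬ h) (suc x) ≤ count 𝒜 x ^ h
        sum-rep≤ x = ≤-trans (sum-mono (suc x) (λ n _ → rep≤ n)) (sum-rep-≤ 𝒜 h x)

  stable : ∀ 𝒜 → 0 ∈ 𝒜 → 1 ∈ 𝒜 → ∀ h → 1 ≤ h →
    ∃[ K ] (∀ x → 1 ≤ count 𝒜 x → count 𝒜 (2 * x) ≤ K * count 𝒜 x) →
    ∃[ K ] (∀ n → 1 ≤ term 𝒜 n → term 𝒜 (2 * n) ≤ K * term 𝒜 n) →
    NatMajorant (rep 𝒜 h) (J 𝒜 h) → IsStableBasis 𝒜
  stable 𝒜 0∈ 1∈ h 1≤h (K₁ , count-doubling) term-bound (Y , (Cʸ , sum-Y-≤) , rep-≤) =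
      -- 𝒜 is treated as a subsequence of itself, with comparison constant 1.
      basis 𝒜 (λ _ n∈ → n∈) 0∈ 1∈ 0 (λ x → m≤m+n (count 𝒜 x) 0)
    , λ ℬ ℬ⊆𝒜 0∈ℬ 1∈ℬ (_ , 𝒜=Oℬ) → dominated ℬ ℬ⊆𝒜 0∈ℬ 1∈ℬ (=O⇒≤ (count 𝒜) (count ℬ) 𝒜=Oℬ)
    where
    basis : ∀ ℬ → ℬ ⊆ 𝒜 → 0 ∈ ℬ → 1 ∈ ℬ → ∀ K → (∀ x → count 𝒜 x ≤ suc K * count ℬ x) → IsAdditiveBasis ℬ
    basis = let K₂ , 2≤K₂ , doubling = term-doubling 𝒜 0∈ 1∈ term-bound in
      subsequence-basis 𝒜 0∈ 1∈ h 1≤h K₁ (λ x → count-doubling x (1≤count {𝒜} 0∈ x)) K₂ 2≤K₂ doubling Y Cʸ sum-Y-≤ rep-≤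
    dominated : ∀ ℬ → ℬ ⊆ 𝒜 → 0 ∈ ℬ → 1 ∈ ℬ →
      ∃[ K ] (∀ x → 1 ≤ count ℬ x → count 𝒜 x ≤ K * count ℬ x) → IsAdditiveBasis ℬ
    dominated ℬ ℬ⊆𝒜 0∈ℬ 1∈ℬ (K , 𝒜≤Kℬ) = basis ℬ ℬ⊆𝒜 0∈ℬ 1∈ℬ K
      (λ x → ≤-trans (𝒜≤Kℬ x (1≤count {ℬ} 0∈ℬ x)) (m≤n+m (K * count ℬ x) (count ℬ x)))

open import Data.Product.Base using (_,_; proj₁)
open import Defs
open Approximation using (=O⇒≤)
open SingularSeries using (natMajorant; J-nonneg)
open Basis using (stable)

theoremA10 : (𝒜 : Sequence) → OR₊ 𝒜 → 0 ∈ 𝒜 → 1 ∈ 𝒜 →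
    (h : ℕ) → 1 ℕ.≤ h →
    (𝔖 E : ℕ → ℝ) → (∀ n → 0ℝ ≤ 𝔖 n) →
    (∀ n → fromℕ (rep 𝒜 h n) ≃ 𝔖 n * fromℚ (J 𝒜 h n) + E n) →
    E =o (λ n → fromℕ (rep 𝒜 h n)) →
    (ε : ℝ) → 0ℝ < ε → BoundedMoment 𝔖 (1ℝ + ε) →
    IsStableBasis 𝒜
theoremA10 𝒜 (count-=O , term-=O) 0∈ 1∈ h 1≤h 𝔖 E _ r≃ E=o ε 0<ε moment = stable 𝒜 0∈ 1∈ h 1≤h
  (=O⇒≤ (λ x → count 𝒜 (2 ℕ.* x)) (count 𝒜) count-=O)
  (=O⇒≤ (λ n → term 𝒜 (2 ℕ.* n)) (term 𝒜) term-=O)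
  (natMajorant (rep 𝒜 h) (J 𝒜 h) (J-nonneg 𝒜 h) 𝔖 E (λ n → proj₁ (r≃ n)) E=o ε 0<ε moment)
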